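{- Let $y$ be an integer such that $p=4y^2+3y+1$ is a prime with $p\ge 5$. Let $\beta\in\{ -8y-4,\ 8y+2\}$, $\mu=2p-2$, $\lambda=\mu+\beta$ and $k=4p^2-2p+\tfrac{\beta}{2}$. Then no nontrivial regular $(8p^3,k,\lambda,\mu)$-PDS exists in an Abelian group of order $8p^3$.
   Context: Let $G$ be a finite Abelian group of order $v$ with identity $e$, and $D\subseteq G$ a subset of size $k$. $D$ is a $(v,k,\lambda,\mu)$-partial difference set (PDS) in $G$ if the expressions $gh^{ -1}$ with $g,h\in D$, $g\neq h$, represent each non-identity element of $D$ exactly $\lambda$ times and each non-identity element of $G$ not in $D$ exactly $\mu$ times. $D$ is regular if moreover $D^{(-1)}=D$ and $e\notin D$. A regular PDS $D$ is trivial if $D\cup\{e\}$ or $G\setminus D$ is a subgroup of $G$. The parameter $\beta$ of a PDS is $\lambda-\mu$. -}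

module Defs where

open import Level using (0ℓ)
open import Data.Nat using (ℕ)
open import Data.Fin using (Fin)
open import Data.Fin.Subset using (Subset; _∈_; _∉_; ∣_∣)
open import Data.Fin.Subset.Properties using (_∈?_)
open import Data.List using (List; length; filter; cartesianProduct; allFin)
open import Data.Product using (_×_; _,_; proj₁; proj₂)
open import Data.Integer using (ℤ; +_)
open import Relation.Binary.PropositionalEquality using (_≡_; _≢_)
open import Relation.Nullary using (¬_; Dec; yes; no)
open import Relation.Nullary.Decidable using (_×-dec_; ¬?)
open import Data.Fin using (_≟_)
open import Algebra.Structures using (IsAbelianGroup)

-- A finite Abelian group of order v: WLOG its carrier is Fin v
-- (every finite Abelian group of order v is isomorphic to such a one).
record FinAbGroup (v : ℕ) : Set where
  field
    _∙_ : Fin v → Fin v → Fin v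
    e   : Fin v
    inv : Fin v → Fin v
    isAbelianGroup : IsAbelianGroup _≡_ _∙_ e inv

module _ {v : ℕ} (G : FinAbGroup v) where
  open FinAbGroup G

  repCount : Subset v → Fin v → ℕ
  repCount D x = length (filter P? (cartesianProduct (allFin v) (allFin v)))
    where
    P? : (gh : Fin v × Fin v) → Dec ((proj₁ gh ∈ D × proj₂ gh ∈ D) × (proj₁ gh ≢ proj₂ gh × (proj₁ gh ∙ inv (proj₂ gh)) ≡ x))
    P? (g , h) = ((g ∈? D) ×-dec (h ∈? D)) ×-dec (¬? (g ≟ h) ×-dec ((g ∙ inv h) ≟ x))

  IsPDS : Subset v → ℤ → ℤ → ℤ → Set
  IsPDS D k lam mu =
    (+ ∣ D ∣ ≡ k)
    × (∀ x → x ≢ e → x ∈ D → + repCount D x ≡ lam)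
    × (∀ x → x ≢ e → x ∉ D → + repCount D x ≡ mu)

  IsRegular : Subset v → Set
  IsRegular D = (∀ x → x ∈ D → inv x ∈ D) × (∀ x → inv x ∈ D → x ∈ D) × (e ∉ D)

  IsSubgroup : (Fin v → Set) → Set
  IsSubgroup S = S e × (∀ x y → S x → S y → S (x ∙ y)) × (∀ x → S x → S (inv x))

  IsTrivial : Subset v → Set
  IsTrivial D = Data.Sum._⊎_ (IsSubgroup (λ x → Data.Sum._⊎_ (x ∈ D) (x ≡ e)))
                             (IsSubgroup (λ x → x ∉ D))
    where import Data.Sum

{-# OPTIONS --safe #-}

-- Write b = β/2.  Since b² + b = 4p - 2, the nontrivial eigenvalues of D are b ± 2p, and the element
-- F = 2p (D - b e) - G of ℤ[G] satisfies F * F = (4p²)² e.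
--
-- (1) For a prime s ∤ 2p, F^s is the image of F under x ↦ x^s modulo s, while F * F = (4p²)² e gives
--     F^s ≡ F; hence D is invariant under x ↦ x^n for every n prime to 2p.
-- (2) Let φ : G → N be the projection onto the Sylow 2-subgroup, with kernel P.  The image of F under φ is
--     p B with B * B = 16p² e.  As 𝔽ₚ[N] is reduced, B = p A with A * A = 16 e.  So A has odd values on the
--     8 elements of N, Σ A = -4 and Σ A² = 16, which forces A n = -1 for some n ≠ e in N, that is,
--     |D ∩ nP| = p (p - 1) / 2.
-- (3) By (1) the group of Teichmüller units modulo p³, of order p - 1, acts freely on (D ∩ nP) \ {n}, so
--     |D ∩ nP| is 0 or 1 modulo p - 1.  This contradicts (2) for p > 3.

module Submission where

open import Defs
open import Level using (Level; 0ℓ)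
open import Algebra.Bundles using (CommutativeRing; AbelianGroup)
open import Algebra.Structures using (IsAbelianGroup)
import Algebra.Construct.Pointwise as Pointwise
import Algebra.Properties.CommutativeMonoid.Mult
import Algebra.Properties.CommutativeMonoid.Sum
import Algebra.Properties.CommutativeSemiring.Exp
import Algebra.Properties.Group
import Algebra.Properties.Semiring.Mult
import Algebra.Properties.Semiring.Sum
open import Data.Bool using (Bool; true; false; if_then_else_)
open import Data.Empty using (⊥)
open import Data.Fin as Fin using (Fin; zero; suc; toℕ; fromℕ<; _≟_)
open import Data.Fin.Properties as Finₚ using (any?; toℕ<n; toℕ-fromℕ<; toℕ-injective)
import Data.Fin.Permutation as Perm
open import Data.Fin.Subset using (Subset; _∈_; ∣_∣; inside; outside)
open import Data.Fin.Subset.Properties using (_∈?_)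
open import Data.Integer as ℤ using (ℤ; +_; -[1+_])
import Data.Integer.Properties as ℤₚ
open import Data.Integer.Tactic.RingSolver using (solve-∀)
open import Data.List using ([]; _∷_; _++_; length; filter; map; cartesianProduct; tabulate)
open import Data.List.Properties using (length-++; filter-++; map-tabulate)
open import Data.List.Relation.Unary.All using (All; []; _∷_)
open import Data.Nat as ℕ using (ℕ; zero; suc; _<_; _∸_; _!; z≤n; s≤s)
open import Data.Nat.Combinatorics using (_C_; nCn≡1; k![n∸k]!∣n!; nCk≡n!/k![n-k]!)
open import Data.Nat.Coprimality as Coprimality using (Coprime; coprime-divisor; coprime-Bézout)
open import Data.Nat.Divisibility as ℕ∣ using (_∣_; divides)
open import Data.Nat.DivMod using (_%_; _/_; m≡m%n+[m/n]*n; m%n<n; m/n*n≡m)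
open import Data.Nat.GCD using (module Bézout)
open import Data.Nat.ListAction using (product)
open import Data.Nat.Primality using (Prime; euclidsLemma; prime⇒nonZero; prime⇒nonTrivial; prime⇒irreducible; prime[2]; ¬prime[0]; ¬prime[1])
open import Data.Nat.Primality.Factorisation using (factorise; module PrimeFactorisation)
import Data.Nat.Properties as ℕₚ
open import Data.Product using (_,_; proj₁; proj₂; ∃)
open import Data.Sum using (_⊎_; inj₁; inj₂)
open import Data.Vec using ([]; _∷_)
open import Function using (_∘_; id; mk⇔)
open import Relation.Binary.Definitions using (tri<; tri≈; tri>)
open import Relation.Binary.PropositionalEquality as ≡ using (_≡_; _≢_; cong; cong₂; subst; subst₂; module ≡-Reasoning)
open import Relation.Nullary using (¬_; Dec; does; yes; no; contradiction)
open import Relation.Nullary.Decidable using (_×-dec_; ¬?; dec-true; dec-false; does-⇔)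
open import Relation.Unary using (Pred; Decidable)

-- Frobenius in characteristic s

-- `F` is normalised so that every character of G takes the value 4p² or -4p² on it. Nontrivial
-- characters give 2p times b ± 2p - b; the trivial one gives 2p (k - b) - 8p³ = -4p². Working with
-- characters would require cyclotomic integers. The proof stays in group rings over ℤ and over the
-- integers modulo a prime, where Frobenius takes their place. N is not a separate group but the
-- image of multiplication by p⁴ on G, and a function on N is a function on G that vanishes
-- elsewhere. The nilpotence argument behind (2) also yields |N| = 8 and |P| = p³, from the
-- indicator functions of N and P. In (2), the sum of (A n + 1)² - 4 over N is 16 - 8 - 24 = -16,
-- and a summand with A n odd is negative only for A n = -1, where it is -4. So A n = -1 at four
-- points or more. The point e must be avoided because there the term b e of `F` shifts the count of
-- D by b.

prime∤! : ∀ {s} → Prime s → ∀ {k} → k < s → ¬ s ∣ k !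
prime∤! s-prime {zero} k<s s∣1 = ℕₚ.<⇒≢ (ℕ.nonTrivial⇒n>1 _ {{prime⇒nonTrivial s-prime}}) (≡.sym (ℕ∣.∣1⇒≡1 s∣1))
prime∤! s-prime {suc k} k<s s∣k! with euclidsLemma (suc k) (k !) s-prime s∣k!
... | inj₁ s∣1+k = ℕₚ.<⇒≱ k<s (ℕ∣.∣⇒≤ s∣1+k)
... | inj₂ s∣k   = prime∤! s-prime (ℕₚ.<-trans (ℕₚ.n<1+n k) k<s) s∣k

-- The prime s divides s! = (s C k) k! (s - k)! but neither of the two smaller factorials.
prime∣C : ∀ {s} → Prime s → ∀ {k} → 0 < k → k < s → s ∣ (s C k)
prime∣C {zero}    s-prime = contradiction s-prime ¬prime[0]
prime∣C {s@(suc s-1)} s-prime {k} 0<k k<s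
  with euclidsLemma (s C k) (k ! ℕ.* (s ∸ k) !) s-prime s∣C*k!*[s-k]!
  where
  instance _ = k ℕₚ.!* (s ∸ k) !≢0
  s∣C*k!*[s-k]! : s ∣ (s C k) ℕ.* (k ! ℕ.* (s ∸ k) !)
  s∣C*k!*[s-k]! = ≡.subst (s ∣_)
    (≡.sym (≡.trans (≡.cong (ℕ._* (k ! ℕ.* (s ∸ k) !)) (nCk≡n!/k![n-k]! (ℕₚ.<⇒≤ k<s)))
                    (m/n*n≡m (k![n∸k]!∣n! (ℕₚ.<⇒≤ k<s)))))
    (ℕ∣.m∣m*n (s-1 !))
... | inj₁ s∣C = s∣C
... | inj₂ s∣k!*[s-k]! with euclidsLemma (k !) ((s ∸ k) !) s-prime s∣k!*[s-k]!
...   | inj₁ s∣k!     = contradiction s∣k! (prime∤! s-prime k<s)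
...   | inj₂ s∣[s-k]! = contradiction s∣[s-k]! (prime∤! s-prime (ℕₚ.∸-monoʳ-< 0<k (ℕₚ.<⇒≤ k<s)))

-- An arbitrary commutative ring, because there are two uses: `ℤ/ s`, for Fermat's little theorem,
-- and the group ring over it.
module Frobenius {c ℓ : Level} (R : CommutativeRing c ℓ) where
  open CommutativeRing R hiding (zero)
  open import Algebra.Properties.Semiring.Sum semiring
  open import Algebra.Properties.Semiring.Mult semiring
  open import Algebra.Properties.CommutativeSemiring.Exp commutativeSemiring
  open import Algebra.Properties.CommutativeSemiring.Binomial commutativeSemiring
  open import Relation.Binary.Reasoning.Setoid setoid

  module _ {s : ℕ} (s-prime : Prime s) (char : ∀ x → s × x ≈ 0#) where

    ∣⇒×≈0 : ∀ {m} → s ∣ m → ∀ x → m × x ≈ 0#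
    ∣⇒×≈0 (divides q ≡.refl) x = begin
      (q ℕ.* s) × x ≈⟨ ×-assocˡ x q s ⟨
      q × (s × x)   ≈⟨ ×-congʳ q (char x) ⟩
      q × 0#        ≈⟨ sum-replicate q ⟨
      sum {q} (λ _ → 0#) ≈⟨ sum-replicate-zero q ⟩
      0#            ∎

    ^-distrib-+ : ∀ x y → (x + y) ^ s ≈ x ^ s + y ^ s
    ^-distrib-+ x y = go s ≡.refl
      where
      go : ∀ t → t ≡ s → (x + y) ^ s ≈ x ^ s + y ^ s
      go zero    ≡.refl = contradiction s-prime ¬prime[0]
      go (suc t) ≡.refl = begin
        (x + y) ^ s ≈⟨ theorem s x y ⟩
        T zero + sum (λ i → T (suc i))
          ≈⟨ +-cong first (sum-init-last {t} (λ i → T (suc i))) ⟩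
        y ^ s + (sum (λ i → T (suc (Fin.inject₁ i))) + T (suc (Fin.fromℕ t)))
          ≈⟨ +-congˡ (+-cong (trans (sum-cong-≋ middle) (sum-replicate-zero t)) last) ⟩
        y ^ s + (0# + x ^ s) ≈⟨ +-congˡ (+-identityˡ _) ⟩
        y ^ s + x ^ s        ≈⟨ +-comm _ _ ⟩
        x ^ s + y ^ s        ∎
        where
        T = binomialTerm x y s
        first : T zero ≈ y ^ s
        first = trans (+-identityʳ _) (*-identityˡ _)
        middle : ∀ (i : Fin t) → T (suc (Fin.inject₁ i)) ≈ 0#
        middle i = ∣⇒×≈0 (prime∣C s-prime (s≤s z≤n) (s≤s (≡.subst (ℕ._< t) (≡.sym (Finₚ.toℕ-inject₁ i)) (Finₚ.toℕ<n i)))) _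
        last : T (suc (Fin.fromℕ t)) ≈ x ^ s
        last = begin
          T (suc (Fin.fromℕ t)) ≡⟨ ≡.cong (λ k → (s C suc k) × (x ^ suc k * y ^ (s ∸ suc k))) (Finₚ.toℕ-fromℕ t) ⟩
          (s C s) × (x ^ s * y ^ (s ∸ s)) ≡⟨ ≡.cong₂ (λ m n → m × (x ^ s * y ^ n)) (nCn≡1 s) (ℕₚ.n∸n≡0 s) ⟩
          1 × (x ^ s * 1#) ≈⟨ ×-homo-1 _ ⟩
          x ^ s * 1# ≈⟨ *-identityʳ _ ⟩
          x ^ s ∎

    0^s≈0 : 0# ^ s ≈ 0#
    0^s≈0 = go s ≡.refl
      where
      go : ∀ t → t ≡ s → 0# ^ s ≈ 0#
      go zero    ≡.refl = contradiction s-prime ¬prime[0]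
      go (suc t) ≡.refl = zeroˡ _

    sum-^ : ∀ {n} (f : Fin n → Carrier) → sum f ^ s ≈ sum (λ i → f i ^ s)
    sum-^ {zero}  f = 0^s≈0
    sum-^ {suc n} f = trans (^-distrib-+ _ _) (+-congˡ (sum-^ (λ i → f (suc i))))

    -- Additivity of Frobenius on x + (-x) gives the sign for s = 2 as well, with no case
    -- distinction on parity.
    -‿^ : ∀ x → (- x) ^ s ≈ - (x ^ s)
    -‿^ x = inverseʳ-unique _ _ (begin
      x ^ s + (- x) ^ s ≈⟨ ^-distrib-+ x (- x) ⟨
      (x + - x) ^ s     ≈⟨ ^-congˡ s (-‿inverseʳ x) ⟩
      0# ^ s            ≈⟨ 0^s≈0 ⟩
      0#                ∎)
      where open import Algebra.Properties.Group +-group using (inverseʳ-unique)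

-- The integers modulo s, and Fermat's little theorem.

infix 4 _≡_[mod_]
-- The quotient is kept as data: each law of congruences becomes a polynomial identity for the ring
-- solver, and the exact quotients are later used to divide by p.
record _≡_[mod_] (a b : ℤ) (s : ℕ) : Set where
  constructor mod
  field quot : ℤ
        a≡b+qs : a ≡ b ℤ.+ quot ℤ.* + s

-- The carrier remains ℤ, with congruence as its equality. An integer-valued function on G is thus
-- at once an element of the group ring over ℤ and over `ℤ/ s`, with the same convolution and no
-- reduction map.
ℤ/ : ℕ → CommutativeRing 0ℓ 0ℓ
ℤ/ s = record
  { Carrier = ℤ ; _≈_ = _≡_[mod s ] ; _+_ = ℤ._+_ ; _*_ = ℤ._*_ ; -_ = ℤ.-_ ; 0# = + 0 ; 1# = + 1
  ; isCommutativeRing = record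
    { isRing = record
      { +-isAbelianGroup = record
        { isGroup = record
          { isMonoid = record
            { isSemigroup = record
              { isMagma = record
                { isEquivalence = record { refl = ≡⇒ ≡.refl ; sym = mod-sym ; trans = mod-trans }
                ; ∙-cong = +-cong }
              ; assoc = λ a b c → ≡⇒ (ℤₚ.+-assoc a b c) }
            ; identity = (λ a → ≡⇒ (ℤₚ.+-identityˡ a)) , (λ a → ≡⇒ (ℤₚ.+-identityʳ a)) }
          ; inverse = (λ a → ≡⇒ (ℤₚ.+-inverseˡ a)) , (λ a → ≡⇒ (ℤₚ.+-inverseʳ a))
          ; ⁻¹-cong = neg-cong }
        ; comm = λ a b → ≡⇒ (ℤₚ.+-comm a b) }
      ; *-cong = *-cong
      ; *-assoc = λ a b c → ≡⇒ (ℤₚ.*-assoc a b c)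
      ; *-identity = (λ a → ≡⇒ (ℤₚ.*-identityˡ a)) , (λ a → ≡⇒ (ℤₚ.*-identityʳ a))
      ; distrib = (λ a b c → ≡⇒ (ℤₚ.*-distribˡ-+ a b c)) , (λ a b c → ≡⇒ (ℤₚ.*-distribʳ-+ a b c)) }
    ; *-comm = λ a b → ≡⇒ (ℤₚ.*-comm a b) } }
  where
  open import Data.Integer using (_+_; _*_; -_)
  ≡⇒ : ∀ {a b} → a ≡ b → a ≡ b [mod s ]
  ≡⇒ {a} ≡.refl = mod (+ 0) (lem a (+ s))
    where lem : ∀ a s → a ≡ a + + 0 * s
          lem = solve-∀
  mod-sym : ∀ {a b} → a ≡ b [mod s ] → b ≡ a [mod s ]
  mod-sym {b = b} (mod q ≡.refl) = mod (- q) (lem b q (+ s))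
    where lem : ∀ b q s → b ≡ b + q * s + - q * s
          lem = solve-∀
  mod-trans : ∀ {a b c} → a ≡ b [mod s ] → b ≡ c [mod s ] → a ≡ c [mod s ]
  mod-trans {c = c} (mod q ≡.refl) (mod r ≡.refl) = mod (q + r) (lem c q r (+ s))
    where lem : ∀ c q r s → c + r * s + q * s ≡ c + (q + r) * s
          lem = solve-∀
  +-cong : ∀ {a b c d} → a ≡ b [mod s ] → c ≡ d [mod s ] → a + c ≡ b + d [mod s ]
  +-cong {b = b} {d = d} (mod q ≡.refl) (mod r ≡.refl) = mod (q + r) (lem b d q r (+ s))
    where lem : ∀ b d q r s → (b + q * s) + (d + r * s) ≡ b + d + (q + r) * s
          lem = solve-∀
  *-cong : ∀ {a b c d} → a ≡ b [mod s ] → c ≡ d [mod s ] → a * c ≡ b * d [mod s ]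
  *-cong {b = b} {d = d} (mod q ≡.refl) (mod r ≡.refl) = mod (b * r + q * d + q * r * + s) (lem b d q r (+ s))
    where lem : ∀ b d q r s → (b + q * s) * (d + r * s) ≡ b * d + (b * r + q * d + q * r * s) * s
          lem = solve-∀
  neg-cong : ∀ {a b} → a ≡ b [mod s ] → - a ≡ - b [mod s ]
  neg-cong {b = b} (mod q ≡.refl) = mod (- q) (lem b q (+ s))
    where lem : ∀ b q s → - (b + q * s) ≡ - b + (- q) * s
          lem = solve-∀

module _ {s : ℕ} where
  open CommutativeRing (ℤ/ s)
  open Algebra.Properties.Semiring.Mult semiring
  open Algebra.Properties.CommutativeSemiring.Exp commutativeSemiring
  open import Relation.Binary.Reasoning.Setoid setoid

  ×≡* : ∀ n a → n × a ≡ + n * a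
  ×≡* zero    a = ≡.refl
  ×≡* (suc n) a = ≡.trans (cong (λ z → a + z) (×≡* n a)) (≡.sym (ℤₚ.suc-* (+ n) a))

  ℤ/-char : ∀ a → s × a ≈ + 0
  ℤ/-char a = mod a (≡.trans (×≡* s a) (≡.trans (ℤₚ.*-comm (+ s) a) (≡.sym (ℤₚ.+-identityˡ _))))

  pos-^ˢ : ∀ a n → + (a ℕ.^ n) ≡ (+ a) ^ n
  pos-^ˢ a zero    = ≡.refl
  pos-^ˢ a (suc n) = ≡.trans (ℤₚ.pos-* a (a ℕ.^ n)) (cong (λ z → + a * z) (pos-^ˢ a n))

  private
    fermat-ℕ : Prime s → ∀ n → (+ n) ^ s ≈ + n
    fermat-ℕ s-prime zero    = Frobenius.0^s≈0 (ℤ/ s) s-prime ℤ/-char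
    fermat-ℕ s-prime (suc n) = begin
      (+ 1 + + n) ^ s     ≈⟨ Frobenius.^-distrib-+ (ℤ/ s) s-prime ℤ/-char (+ 1) (+ n) ⟩
      (+ 1) ^ s + (+ n) ^ s ≈⟨ +-cong (reflexive (1^ s)) (fermat-ℕ s-prime n) ⟩
      + 1 + + n           ∎
      where
      1^ : ∀ k → (+ 1) ^ k ≡ + 1
      1^ zero    = ≡.refl
      1^ (suc k) = ≡.trans (ℤₚ.*-identityˡ _) (1^ k)

  fermat : Prime s → ∀ a → a ^ s ≈ a
  fermat s-prime (+ n)    = fermat-ℕ s-prime n
  fermat s-prime -[1+ n ] = trans (Frobenius.-‿^ (ℤ/ s) s-prime ℤ/-char (+ suc n)) (-‿cong (fermat-ℕ s-prime (suc n)))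

-- Multiples of elements in a finite Abelian group.

module Powers {v : ℕ} (G : FinAbGroup v) where
  open FinAbGroup G
  module G = IsAbelianGroup isAbelianGroup

  abelianGroup : AbelianGroup 0ℓ 0ℓ
  abelianGroup = record { isAbelianGroup = isAbelianGroup }

  open AbelianGroup abelianGroup using (commutativeMonoid; group)
  open Algebra.Properties.CommutativeMonoid.Mult commutativeMonoid public
    using () renaming (_×_ to _·_; ×-homo-+ to ·-homo-+; ×-assocˡ to ·-assocˡ; ×-distrib-+ to ·-distrib-∙)
  open Algebra.Properties.Group group public
    using (identityʳ-unique; ∙-cancelˡ; ⁻¹-involutive; identityˡ-unique)
  open Algebra.Properties.CommutativeMonoid.Sum commutativeMonoid using (sum; ∑-distrib-+; sum-replicate; sum-permute)
  open ≡-Reasoning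

  ·-e : ∀ n → n · e ≡ e
  ·-e zero    = ≡.refl
  ·-e (suc n) = ≡.trans (G.identityˡ _) (·-e n)

  inv-∙-cancelˡ : ∀ x y → inv x ∙ (x ∙ y) ≡ y
  inv-∙-cancelˡ x y = ≡.trans (≡.sym (G.assoc _ _ _)) (≡.trans (cong (_∙ y) (G.inverseˡ x)) (G.identityˡ y))

  ∙-inv-cancelˡ : ∀ x y → x ∙ (inv x ∙ y) ≡ y
  ∙-inv-cancelˡ x y = ≡.trans (≡.sym (G.assoc _ _ _)) (≡.trans (cong (_∙ y) (G.inverseʳ x)) (G.identityˡ y))

  -- Translation by x permutes G, so the product of all elements is multiplied by v · x and unchanged.
  v·x≡e : ∀ x → v · x ≡ e
  v·x≡e x = identityˡ-unique (v · x) (sum id) (begin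
    (v · x) ∙ sum id                   ≡⟨ cong (_∙ sum id) (sum-replicate v) ⟨
    sum {v} (λ _ → x) ∙ sum id       ≡⟨ ∑-distrib-+ (λ _ → x) id ⟨
    sum (λ y → x ∙ y)                ≡⟨ sum-permute id (Perm.permutation (x ∙_) (inv x ∙_) (∙-inv-cancelˡ x) (inv-∙-cancelˡ x)) ⟨
    sum id                           ∎)

  ·-inverse : ∀ n x → n · inv x ≡ inv (n · x)
  ·-inverse n x = Algebra.Properties.Group.inverseˡ-unique group (n · inv x) (n · x) (begin
    (n · inv x) ∙ (n · x) ≡⟨ ·-distrib-∙ (inv x) x n ⟨
    n · (inv x ∙ x)   ≡⟨ cong (n ·_) (G.inverseˡ x) ⟩
    n · e             ≡⟨ ·-e n ⟩
    e                 ∎)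

  multiple-·≡e : ∀ {n x} k → n · x ≡ e → (k ℕ.* n) · x ≡ e
  multiple-·≡e {n} {x} k n·x≡e = begin
    (k ℕ.* n) · x ≡⟨ ·-assocˡ x k n ⟨
    k · (n · x)   ≡⟨ cong (k ·_) n·x≡e ⟩
    k · e         ≡⟨ ·-e k ⟩
    e             ∎

  ·-coprime : ∀ {m n x} → Coprime m n → m · x ≡ e → n · x ≡ e → x ≡ e
  ·-coprime {m} {n} {x} cop m·x≡e n·x≡e with coprime-Bézout cop
  ... | Bézout.+- k l eq = begin
    x                   ≡⟨ G.identityʳ x ⟨
    x ∙ e               ≡⟨ cong (x ∙_) (multiple-·≡e l n·x≡e) ⟨
    (1 ℕ.+ l ℕ.* n) · x ≡⟨ cong (_· x) eq ⟩
    (k ℕ.* m) · x       ≡⟨ multiple-·≡e k m·x≡e ⟩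
    e                   ∎
  ... | Bézout.-+ k l eq = begin
    x                   ≡⟨ G.identityʳ x ⟨
    x ∙ e               ≡⟨ cong (x ∙_) (multiple-·≡e k m·x≡e) ⟨
    (1 ℕ.+ k ℕ.* m) · x ≡⟨ cong (_· x) eq ⟩
    (l ℕ.* n) · x       ≡⟨ multiple-·≡e l n·x≡e ⟩
    e                   ∎

  ·-mod : ∀ {d m n x} → d · x ≡ e → (+ m) ≡ (+ n) [mod d ] → m · x ≡ n · x
  ·-mod {d} {m} {n} {x} d·x≡e (mod (+ q) eq) = begin
    m · x             ≡⟨ cong (_· x) (ℤₚ.+-injective (≡.trans eq (cong (λ z → + n ℤ.+ z) (≡.sym (ℤₚ.pos-* q d))))) ⟩
    (n ℕ.+ q ℕ.* d) · x     ≡⟨ ·-homo-+ x n (q ℕ.* d) ⟩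
    (n · x) ∙ ((q ℕ.* d) · x) ≡⟨ cong ((n · x) ∙_) (multiple-·≡e q d·x≡e) ⟩
    (n · x) ∙ e         ≡⟨ G.identityʳ _ ⟩
    n · x             ∎
  ·-mod {d} {m} {n} {x} d·x≡e m≡n@(mod -[1+ q ] eq) = ≡.sym (·-mod {d} {n} {m} d·x≡e
    (mod (+ suc q) (≡.trans (lem (+ n) (+ suc q) (+ d)) (cong (λ z → z ℤ.+ + suc q ℤ.* + d) (≡.sym eq)))))
    where
    lem : ∀ n q d → n ≡ n ℤ.+ ℤ.- q ℤ.* d ℤ.+ q ℤ.* d
    lem = solve-∀

  -- The element `inv x ∙ a` is killed by both s and d, so it is trivial by Bézout.
  ·-injective : ∀ {s d a x} → Coprime s d → d · a ≡ e → d · x ≡ e → s · a ≡ s · x → a ≡ x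
  ·-injective {s} {d} {a} {x} s⊥d d·a≡e d·x≡e s·a≡s·x = begin
    a               ≡⟨ ∙-inv-cancelˡ x a ⟨
    x ∙ (inv x ∙ a) ≡⟨ cong (x ∙_) (·-coprime s⊥d (kill s (≡.sym s·a≡s·x)) (kill d (≡.trans d·x≡e (≡.sym d·a≡e)))) ⟩
    x ∙ e           ≡⟨ G.identityʳ x ⟩
    x               ∎
    where
    kill : ∀ n → n · x ≡ n · a → n · (inv x ∙ a) ≡ e
    kill n eq = begin
      n · (inv x ∙ a)         ≡⟨ ·-distrib-∙ (inv x) a n ⟩
      (n · inv x) ∙ (n · a)   ≡⟨ cong₂ _∙_ (·-inverse n x) (≡.sym eq) ⟩
      inv (n · x) ∙ (n · x)   ≡⟨ G.inverseˡ _ ⟩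
      e                       ∎

-- The group ring of a finite Abelian group

module FinSum {c ℓ : Level} (K : CommutativeRing c ℓ) where
  open CommutativeRing K hiding (zero)
  open import Algebra.Properties.Semiring.Sum semiring
  open import Relation.Binary.Reasoning.Setoid setoid

  δ : ∀ {n} → Fin n → Fin n → Carrier
  δ a b = if does (a ≟ b) then 1# else 0#

  ⟨_,_⟩ : ∀ {n} → (Fin n → Carrier) → (Fin n → Carrier) → Carrier
  ⟨ f , h ⟩ = sum (λ x → f x * h x)

  ⟨⟩-cong : ∀ {n} {f f′ h h′ : Fin n → Carrier} → (∀ x → f x ≈ f′ x) → (∀ x → h x ≈ h′ x) → ⟨ f , h ⟩ ≈ ⟨ f′ , h′ ⟩
  ⟨⟩-cong p q = sum-cong-≋ (λ x → *-cong (p x) (q x))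

  ⟨⟩-congʳ : ∀ {n} (f : Fin n → Carrier) {h h′ : Fin n → Carrier} → (∀ x → h x ≈ h′ x) → ⟨ f , h ⟩ ≈ ⟨ f , h′ ⟩
  ⟨⟩-congʳ f = ⟨⟩-cong {f = f} (λ _ → refl)

  ⟨⟩-comm : ∀ {n} (f h : Fin n → Carrier) → ⟨ f , h ⟩ ≈ ⟨ h , f ⟩
  ⟨⟩-comm f h = sum-cong-≋ (λ x → *-comm (f x) (h x))

  ⟨⟩-distribˡ-+ : ∀ {n} (f g h : Fin n → Carrier) → ⟨ (λ x → f x + g x) , h ⟩ ≈ ⟨ f , h ⟩ + ⟨ g , h ⟩
  ⟨⟩-distribˡ-+ f g h = trans (sum-cong-≋ (λ x → distribʳ (h x) (f x) (g x))) (∑-distrib-+ (λ x → f x * h x) (λ x → g x * h x))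

  ⟨⟩-scaleˡ : ∀ {n} k (f h : Fin n → Carrier) → ⟨ (λ x → k * f x) , h ⟩ ≈ k * ⟨ f , h ⟩
  ⟨⟩-scaleˡ k f h = trans (sum-cong-≋ (λ x → *-assoc k (f x) (h x))) (sym (*-distribˡ-sum k (λ x → f x * h x)))

  ⟨δ,⟩ : ∀ {n} (a : Fin n) (h : Fin n → Carrier) → ⟨ δ a , h ⟩ ≈ h a
  ⟨δ,⟩ {suc n} zero h = begin
    1# * h zero + sum (λ x → 0# * h (suc x)) ≈⟨ +-cong (*-identityˡ _) (sum-cong-≋ {n} (λ x → zeroˡ (h (suc x)))) ⟩
    h zero + sum {n} (λ x → 0#)              ≈⟨ +-congˡ (sum-replicate-zero n) ⟩
    h zero + 0#                              ≈⟨ +-identityʳ _ ⟩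
    h zero                                   ∎
  ⟨δ,⟩ {suc n} (suc a) h = trans (+-cong (zeroˡ _) (⟨δ,⟩ a (h ∘ suc))) (+-identityˡ _)

  δ-refl : ∀ {n} (a : Fin n) → δ a a ≡ 1#
  δ-refl a with a ≟ a
  ... | yes _  = ≡.refl
  ... | no a≢a = contradiction ≡.refl a≢a

  δ-≢ : ∀ {n} {a b : Fin n} → a ≢ b → δ a b ≡ 0#
  δ-≢ {a = a} {b} a≢b with a ≟ b
  ... | yes a≡b = contradiction a≡b a≢b
  ... | no _    = ≡.refl

  δ-⇔ : ∀ {m n} {a b : Fin m} {c d : Fin n} → (a ≡ b → c ≡ d) → (c ≡ d → a ≡ b) → δ a b ≡ δ c d
  δ-⇔ {a = a} {b} {c} {d} to from with a ≟ b
  ... | yes a≡b rewrite to a≡b = ≡.sym (δ-refl d)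
  ... | no a≢b  = ≡.sym (δ-≢ (a≢b ∘ from))

  δ-sym : ∀ {n} (a b : Fin n) → δ a b ≡ δ b a
  δ-sym a b = δ-⇔ {a = a} {b} ≡.sym ≡.sym

  -- Pairing with `δ x` recovers the value at x. Convolution and pushforward have descriptions
  -- without δ as functionals (`⟨⊛,⟩`, `⟨push,⟩`), so most of their identities are checked against a
  -- test function.
  ⟨⟩-ext : ∀ {n} {f g : Fin n → Carrier} → (∀ h → ⟨ f , h ⟩ ≈ ⟨ g , h ⟩) → ∀ x → f x ≈ g x
  ⟨⟩-ext {f = f} {g} p x = begin
    f x         ≈⟨ ⟨δ,⟩ x f ⟨
    ⟨ δ x , f ⟩ ≈⟨ ⟨⟩-comm (δ x) f ⟩
    ⟨ f , δ x ⟩ ≈⟨ p (δ x) ⟩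
    ⟨ g , δ x ⟩ ≈⟨ ⟨⟩-comm g (δ x) ⟩
    ⟨ δ x , g ⟩ ≈⟨ ⟨δ,⟩ x g ⟩
    g x         ∎

  ⟨⟩-swap : ∀ {m n} (f : Fin m → Carrier) (g : Fin n → Carrier) (k : Fin m → Fin n → Carrier) →
            ⟨ f , (λ a → ⟨ g , k a ⟩) ⟩ ≈ ⟨ g , (λ b → ⟨ f , (λ a → k a b) ⟩) ⟩
  ⟨⟩-swap f g k = begin
    sum (λ a → f a * sum (λ b → g b * k a b))   ≈⟨ sum-cong-≋ (λ a → *-distribˡ-sum (f a) (λ b → g b * k a b)) ⟩
    sum (λ a → sum (λ b → f a * (g b * k a b))) ≈⟨ ∑-comm (λ a b → f a * (g b * k a b)) ⟩
    sum (λ b → sum (λ a → f a * (g b * k a b))) ≈⟨ sum-cong-≋ (λ b → sum-cong-≋ (λ a → x∙yz≈y∙xz (f a) (g b) (k a b))) ⟩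
    sum (λ b → sum (λ a → g b * (f a * k a b))) ≈⟨ sum-cong-≋ (λ b → *-distribˡ-sum (g b) (λ a → f a * k a b)) ⟨
    sum (λ b → g b * sum (λ a → f a * k a b))   ∎
    where open import Algebra.Properties.CommutativeSemigroup *-commutativeSemigroup using (x∙yz≈y∙xz)

  ⟨⟩-assoc : ∀ {m n} (f : Fin m → Carrier) (k : Fin m → Fin n → Carrier) (h : Fin n → Carrier) →
             ⟨ (λ x → ⟨ f , (λ a → k a x) ⟩) , h ⟩ ≈ ⟨ f , (λ a → ⟨ k a , h ⟩) ⟩
  ⟨⟩-assoc f k h = begin
    ⟨ (λ x → ⟨ f , (λ a → k a x) ⟩) , h ⟩ ≈⟨ ⟨⟩-comm _ h ⟩
    ⟨ h , (λ x → ⟨ f , (λ a → k a x) ⟩) ⟩ ≈⟨ ⟨⟩-swap h f (λ x a → k a x) ⟩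
    ⟨ f , (λ a → ⟨ h , k a ⟩) ⟩           ≈⟨ ⟨⟩-congʳ f (λ a → ⟨⟩-comm h (k a)) ⟩
    ⟨ f , (λ a → ⟨ k a , h ⟩) ⟩           ∎

  push : ∀ {m n} → (Fin m → Fin n) → (Fin m → Carrier) → Fin n → Carrier
  push φ f x = ⟨ f , (λ a → δ (φ a) x) ⟩

  ⟨push,⟩ : ∀ {m n} (φ : Fin m → Fin n) f h → ⟨ push φ f , h ⟩ ≈ ⟨ f , h ∘ φ ⟩
  ⟨push,⟩ φ f h = trans (⟨⟩-assoc f (δ ∘ φ) h) (⟨⟩-congʳ f (λ a → ⟨δ,⟩ (φ a) h))

  -- Injectivity is asked for only where f does not vanish in K: multiplication by s is known to be
  -- injective on the d-torsion, which has to contain the support only.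
  push-injective : ∀ {m n} {φ : Fin m → Fin n} f x → (∀ a → φ a ≡ φ x → a ≡ x ⊎ f a ≈ 0#) → push φ f (φ x) ≈ f x
  push-injective {φ = φ} f x inj = begin
    ⟨ f , (λ a → δ (φ a) (φ x)) ⟩ ≈⟨ sum-cong-≋ term ⟩
    ⟨ f , δ x ⟩                   ≈⟨ ⟨⟩-comm f (δ x) ⟩
    ⟨ δ x , f ⟩                   ≈⟨ ⟨δ,⟩ x f ⟩
    f x                           ∎
    where
    term : ∀ a → f a * δ (φ a) (φ x) ≈ f a * δ x a
    term a with φ a ≟ φ x
    ... | no φa≢φx = *-congˡ (reflexive (≡.sym (δ-≢ (λ x≡a → φa≢φx (≡.cong φ (≡.sym x≡a))))))
    ... | yes φa≡φx with inj a φa≡φx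
    ...   | inj₁ ≡.refl = *-congˡ (reflexive (≡.sym (δ-refl a)))
    ...   | inj₂ fa≈0   = trans (*-congʳ fa≈0) (trans (zeroˡ _) (sym (trans (*-congʳ fa≈0) (zeroˡ _))))

module GroupRing {c ℓ : Level} (K : CommutativeRing c ℓ) {v : ℕ} (G : FinAbGroup v) where
  open CommutativeRing K hiding (zero)
  open Algebra.Properties.Semiring.Sum semiring
  open import Relation.Binary.Reasoning.Setoid setoid
  open FinSum K public
  open FinAbGroup G
  open Powers G

  infixl 7 _⊛_
  -- Convolution, written with δ instead of g (a⁻¹ x) so that both factors enter symmetrically;
  -- `⊛-expand` recovers the usual formula.
  _⊛_ : (Fin v → Carrier) → (Fin v → Carrier) → Fin v → Carrier
  (f ⊛ g) x = ⟨ f , (λ a → ⟨ g , (λ b → δ (a ∙ b) x) ⟩) ⟩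

  ⟨⊛,⟩ : ∀ f g h → ⟨ f ⊛ g , h ⟩ ≈ ⟨ f , (λ a → ⟨ g , (λ b → h (a ∙ b)) ⟩) ⟩
  ⟨⊛,⟩ f g h = begin
    ⟨ f ⊛ g , h ⟩                                                ≈⟨ ⟨⟩-assoc f _ h ⟩
    ⟨ f , (λ a → ⟨ (λ x → ⟨ g , (λ b → δ (a ∙ b) x) ⟩) , h ⟩) ⟩   ≈⟨ ⟨⟩-congʳ f (λ a → ⟨⟩-assoc g _ h) ⟩
    ⟨ f , (λ a → ⟨ g , (λ b → ⟨ δ (a ∙ b) , h ⟩) ⟩) ⟩            ≈⟨ ⟨⟩-congʳ f (λ a → ⟨⟩-congʳ g (λ b → ⟨δ,⟩ (a ∙ b) h)) ⟩
    ⟨ f , (λ a → ⟨ g , (λ b → h (a ∙ b)) ⟩) ⟩                    ∎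

  groupRing : CommutativeRing c ℓ
  groupRing = record
    { Carrier = Fin v → Carrier
    ; _≈_ = λ f g → ∀ x → f x ≈ g x
    ; _+_ = λ f g x → f x + g x
    ; _*_ = _⊛_
    ; -_ = λ f x → - f x
    ; 0# = λ _ → 0#
    ; 1# = δ e
    ; isCommutativeRing = record
      { isRing = record
        { +-isAbelianGroup = Pointwise.isAbelianGroup (Fin v) +-isAbelianGroup
        ; *-cong = λ p q x → ⟨⟩-cong p (λ a → ⟨⟩-cong q (λ b → refl))
        ; *-assoc = ⊛-assoc
        ; *-identity = ⊛-identityˡ , λ f x → trans (⊛-comm f (δ e) x) (⊛-identityˡ f x)
        ; distrib = (λ f g h x → trans (⊛-comm f _ x) (trans (⊛-distribʳ f g h x) (+-cong (⊛-comm g f x) (⊛-comm h f x)))) , ⊛-distribʳ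
        }
      ; *-comm = ⊛-comm
      }
    }
    where
    ⊛-comm : ∀ f g x → (f ⊛ g) x ≈ (g ⊛ f) x
    ⊛-comm f g x = trans (⟨⟩-swap f g _) (⟨⟩-congʳ g (λ b → ⟨⟩-congʳ f (λ a → reflexive (≡.cong (λ c → δ c x) (G.comm a b)))))

    ⊛-assoc : ∀ f g h x → ((f ⊛ g) ⊛ h) x ≈ (f ⊛ (g ⊛ h)) x
    ⊛-assoc f g h = ⟨⟩-ext λ k → begin
      ⟨ (f ⊛ g) ⊛ h , k ⟩ ≈⟨ ⟨⊛,⟩ (f ⊛ g) h k ⟩
      ⟨ f ⊛ g , (λ y → ⟨ h , (λ z → k (y ∙ z)) ⟩) ⟩ ≈⟨ ⟨⊛,⟩ f g _ ⟩
      ⟨ f , (λ a → ⟨ g , (λ b → ⟨ h , (λ z → k ((a ∙ b) ∙ z)) ⟩) ⟩) ⟩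
        ≈⟨ ⟨⟩-congʳ f (λ a → ⟨⟩-congʳ g (λ b → ⟨⟩-congʳ h (λ z → reflexive (≡.cong k (G.assoc a b z))))) ⟩
      ⟨ f , (λ a → ⟨ g , (λ b → ⟨ h , (λ z → k (a ∙ (b ∙ z))) ⟩) ⟩) ⟩
        ≈⟨ ⟨⟩-congʳ f (λ a → ⟨⊛,⟩ g h (λ y → k (a ∙ y))) ⟨
      ⟨ f , (λ a → ⟨ g ⊛ h , (λ y → k (a ∙ y)) ⟩) ⟩ ≈⟨ ⟨⊛,⟩ f (g ⊛ h) k ⟨
      ⟨ f ⊛ (g ⊛ h) , k ⟩ ∎

    ⊛-identityˡ : ∀ f x → (δ e ⊛ f) x ≈ f x
    ⊛-identityˡ f = ⟨⟩-ext λ h → begin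
      ⟨ δ e ⊛ f , h ⟩ ≈⟨ ⟨⊛,⟩ (δ e) f h ⟩
      ⟨ δ e , (λ a → ⟨ f , (λ b → h (a ∙ b)) ⟩) ⟩ ≈⟨ ⟨δ,⟩ e _ ⟩
      ⟨ f , (λ b → h (e ∙ b)) ⟩ ≈⟨ ⟨⟩-congʳ f (λ b → reflexive (≡.cong h (G.identityˡ b))) ⟩
      ⟨ f , h ⟩ ∎

    ⊛-distribʳ : ∀ f g h x → ((λ y → g y + h y) ⊛ f) x ≈ (g ⊛ f) x + (h ⊛ f) x
    ⊛-distribʳ f g h x = ⟨⟩-distribˡ-+ g h _

  sum-translate : ∀ c (h : Fin v → Carrier) → sum (λ x → h (c ∙ x)) ≈ sum h
  sum-translate c h = sym (sum-permute h (Perm.permutation (c ∙_) (inv c ∙_) (∙-inv-cancelˡ c) (inv-∙-cancelˡ c)))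

  sum-inverse : ∀ (h : Fin v → Carrier) → sum (λ x → h (inv x)) ≈ sum h
  sum-inverse h = sym (sum-permute h (Perm.permutation inv inv ⁻¹-involutive ⁻¹-involutive))

  δ-∙ : ∀ a b x → δ (a ∙ b) x ≡ δ (inv a ∙ x) b
  δ-∙ a b x = δ-⇔ {a = a ∙ b} {x} {inv a ∙ x} {b} (λ { ≡.refl → inv-∙-cancelˡ a b }) (λ { ≡.refl → ∙-inv-cancelˡ a x })

  ⊛-expand : ∀ f g x → (f ⊛ g) x ≈ ⟨ f , (λ a → g (inv a ∙ x)) ⟩
  ⊛-expand f g x = ⟨⟩-congʳ f λ a → begin
    ⟨ g , (λ b → δ (a ∙ b) x) ⟩ ≈⟨ ⟨⟩-congʳ g (λ b → reflexive (δ-∙ a b x)) ⟩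
    ⟨ g , δ (inv a ∙ x) ⟩       ≈⟨ ⟨⟩-comm g _ ⟩
    ⟨ δ (inv a ∙ x) , g ⟩       ≈⟨ ⟨δ,⟩ (inv a ∙ x) g ⟩
    g (inv a ∙ x)               ∎

  -- Each term of the convolution is f a times a translate of χ, which is χ itself wherever f a
  -- counts. This covers the sum of all group elements and the square of the indicator of a
  -- subgroup.
  ⊛-invariant : ∀ f χ → (∀ a → f a ≈ 0# ⊎ (∀ x → χ (inv a ∙ x) ≈ χ x)) → ∀ x → (f ⊛ χ) x ≈ sum f * χ x
  ⊛-invariant f χ inv-or-0 x = begin
    (f ⊛ χ) x                       ≈⟨ ⊛-expand f χ x ⟩
    ⟨ f , (λ a → χ (inv a ∙ x)) ⟩   ≈⟨ sum-cong-≋ term ⟩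
    sum (λ a → f a * χ x)           ≈⟨ *-distribʳ-sum (χ x) f ⟨
    sum f * χ x                     ∎
    where
    term : ∀ a → f a * χ (inv a ∙ x) ≈ f a * χ x
    term a with inv-or-0 a
    ... | inj₁ fa≈0 = trans (*-congʳ fa≈0) (trans (zeroˡ _) (sym (trans (*-congʳ fa≈0) (zeroˡ _))))
    ... | inj₂ eq   = *-congˡ (eq x)

  private module R = CommutativeRing groupRing
  module RExp = Algebra.Properties.CommutativeSemiring.Exp R.commutativeSemiring
  open RExp public using () renaming (_^_ to _⊛^_)

  ⊛-scaleˡ : ∀ k f g x → ((λ y → k * f y) ⊛ g) x ≈ k * (f ⊛ g) x
  ⊛-scaleˡ k f g x = ⟨⟩-scaleˡ k f _

  push-⊛ : ∀ {φ : Fin v → Fin v} → (∀ a b → φ (a ∙ b) ≡ φ a ∙ φ b) →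
           ∀ f g x → push φ (f ⊛ g) x ≈ (push φ f ⊛ push φ g) x
  push-⊛ {φ} φ-homo f g = ⟨⟩-ext λ h → begin
    ⟨ push φ (f ⊛ g) , h ⟩                               ≈⟨ ⟨push,⟩ φ (f ⊛ g) h ⟩
    ⟨ f ⊛ g , h ∘ φ ⟩                                    ≈⟨ ⟨⊛,⟩ f g _ ⟩
    ⟨ f , (λ a → ⟨ g , (λ b → h (φ (a ∙ b))) ⟩) ⟩        ≈⟨ ⟨⟩-congʳ f (λ a → ⟨⟩-congʳ g (λ b → reflexive (≡.cong h (φ-homo a b)))) ⟩
    ⟨ f , (λ a → ⟨ g , (λ b → h (φ a ∙ φ b)) ⟩) ⟩        ≈⟨ ⟨⟩-congʳ f (λ a → ⟨push,⟩ φ g (λ y → h (φ a ∙ y))) ⟨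
    ⟨ f , (λ a → ⟨ push φ g , (λ y → h (φ a ∙ y)) ⟩) ⟩   ≈⟨ ⟨push,⟩ φ f _ ⟨
    ⟨ push φ f , (λ x → ⟨ push φ g , (λ y → h (x ∙ y)) ⟩) ⟩ ≈⟨ ⟨⊛,⟩ (push φ f) (push φ g) h ⟨
    ⟨ push φ f ⊛ push φ g , h ⟩                          ∎

  single : Carrier → Fin v → Fin v → Carrier
  single k g x = k * δ g x

  ⟨single,⟩ : ∀ k g h → ⟨ single k g , h ⟩ ≈ k * h g
  ⟨single,⟩ k g h = trans (⟨⟩-scaleˡ k (δ g) h) (*-congˡ (⟨δ,⟩ g h))

  single-⊛ : ∀ k g l h x → (single k g ⊛ single l h) x ≈ single (k * l) (g ∙ h) x
  single-⊛ k g l h = ⟨⟩-ext λ t → begin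
    ⟨ single k g ⊛ single l h , t ⟩ ≈⟨ ⟨⊛,⟩ (single k g) (single l h) t ⟩
    ⟨ single k g , (λ a → ⟨ single l h , (λ b → t (a ∙ b)) ⟩) ⟩ ≈⟨ ⟨single,⟩ k g _ ⟩
    k * ⟨ single l h , (λ b → t (g ∙ b)) ⟩ ≈⟨ *-congˡ (⟨single,⟩ l h _) ⟩
    k * (l * t (g ∙ h)) ≈⟨ *-assoc k l _ ⟨
    (k * l) * t (g ∙ h) ≈⟨ ⟨single,⟩ (k * l) (g ∙ h) t ⟨
    ⟨ single (k * l) (g ∙ h) , t ⟩ ∎

  open Algebra.Properties.CommutativeSemiring.Exp commutativeSemiring using (_^_)
  open Algebra.Properties.Semiring.Mult semiring using (_×_)

  single-^ : ∀ k g n x → (single k g ⊛^ n) x ≈ single (k ^ n) (n · g) x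
  single-^ k g zero    x = sym (*-identityˡ _)
  single-^ k g (suc n) x = trans (R.*-cong (λ _ → refl) (single-^ k g n) x) (single-⊛ k g (k ^ n) (n · g) x)

  private
    sumᴿ-apply : ∀ {n} (t : Fin n → Fin v → Carrier) x →
                 Algebra.Properties.Semiring.Sum.sum R.semiring t x ≡ sum (λ i → t i x)
    sumᴿ-apply {zero}  t x = ≡.refl
    sumᴿ-apply {suc n} t x = ≡.cong (λ z → t zero x + z) (sumᴿ-apply (t ∘ suc) x)

    ×ᴿ-apply : ∀ n (f : Fin v → Carrier) x → Algebra.Properties.Semiring.Mult._×_ R.semiring n f x ≡ n × f x
    ×ᴿ-apply zero    f x = ≡.refl
    ×ᴿ-apply (suc n) f x = ≡.cong (λ z → f x + z) (×ᴿ-apply n f x)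

  -- Write f as the sum of its one-point parts `single (f g) g`. Frobenius is additive in the group
  -- ring, and it sends such a part to the coefficient f g ^ s, which is f g by Fermat, at the
  -- element s · g.
  frobenius : ∀ {s} → Prime s → (∀ k → s × k ≈ 0#) → (∀ k → k ^ s ≈ k) →
              ∀ f x → (f ⊛^ s) x ≈ push (s ·_) f x
  frobenius {s} s-prime char fermat f x = begin
    (f ⊛^ s) x ≈⟨ RExp.^-congˡ s f≈Σ x ⟩
    -- The characteristic of the group ring is inherited pointwise from K.
    (sumᴿ (λ g → single (f g) g) ⊛^ s) x ≈⟨ Frobenius.sum-^ groupRing s-prime (λ h y → trans (reflexive (×ᴿ-apply s h y)) (char (h y))) (λ g → single (f g) g) x ⟩
    sumᴿ (λ g → single (f g) g ⊛^ s) x ≡⟨ sumᴿ-apply (λ g → single (f g) g ⊛^ s) x ⟩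
    sum (λ g → (single (f g) g ⊛^ s) x) ≈⟨ sum-cong-≋ (λ g → trans (single-^ (f g) g s x) (*-congʳ (fermat (f g)))) ⟩
    push (s ·_) f x ∎
    where
    sumᴿ = Algebra.Properties.Semiring.Sum.sum R.semiring {v}
    f≈Σ : ∀ y → f y ≈ sumᴿ (λ g → single (f g) g) y
    f≈Σ y = begin
      f y ≈⟨ ⟨δ,⟩ y f ⟨
      ⟨ δ y , f ⟩ ≈⟨ ⟨⟩-comm (δ y) f ⟩
      ⟨ f , δ y ⟩ ≈⟨ ⟨⟩-congʳ f (λ g → reflexive (δ-sym y g)) ⟩
      sum (λ g → single (f g) g y) ≡⟨ sumᴿ-apply (λ g → single (f g) g) y ⟨
      sumᴿ (λ g → single (f g) g) y ∎

-- Coprimality, divisibility and finite sums of integers.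

open import Data.Integer using (_+_; _*_; -_; _-_)
open import Data.Product using (_×_)
open ≡ using (refl; sym; trans)

pos-^ : ∀ a n → + (a ℕ.^ n) ≡ (+ a) ℤ.^ n
pos-^ a zero    = refl
pos-^ a (suc n) = trans (ℤₚ.pos-* a (a ℕ.^ n)) (cong (λ z → + a * z) (pos-^ a n))

coprime-* : ∀ {m n o} → Coprime m n → Coprime m o → Coprime m (n ℕ.* o)
coprime-* m⊥n m⊥o (d∣m , d∣n*o) = m⊥o (d∣m , coprime-divisor (λ { (c∣d , c∣n) → m⊥n (ℕ∣.∣-trans c∣d d∣m , c∣n) }) d∣n*o)

coprime-^ : ∀ {m n} k → Coprime m n → Coprime m (n ℕ.^ k)
coprime-^ zero    m⊥n = Coprimality.sym (Coprimality.1-coprimeTo _)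
coprime-^ (suc k) m⊥n = coprime-* m⊥n (coprime-^ k m⊥n)

prime∤⇒coprime : ∀ {s n} → Prime s → ¬ s ℕ∣.∣ n → Coprime s n
prime∤⇒coprime s-prime s∤n (d∣s , d∣n) with prime⇒irreducible s-prime d∣s
... | inj₁ d≡1  = d≡1
... | inj₂ refl = contradiction d∣n s∤n

≡0⇒∣ : ∀ {a s} → a ≡ + 0 [mod s ] → s ℕ∣.∣ ℤ.∣ a ∣
≡0⇒∣ {s = s} (mod q refl) = ℕ∣.divides ℤ.∣ q ∣ (trans (cong ℤ.∣_∣ (ℤₚ.+-identityˡ (q * + s))) (ℤₚ.abs-* q (+ s)))

∣⇒≡0 : ∀ {a s} → s ℕ∣.∣ ℤ.∣ a ∣ → a ≡ + 0 [mod s ]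
∣⇒≡0 {+ n} {s}      (ℕ∣.divides q eq) = mod (+ q) (trans (cong +_ eq) (trans (ℤₚ.pos-* q s) (sym (ℤₚ.+-identityˡ _))))
∣⇒≡0 { -[1+ n ] } {s} (ℕ∣.divides q eq) = mod (- + q) (trans (cong (λ m → - + m) eq) (trans (cong -_ (ℤₚ.pos-* q s)) (lem (+ q) (+ s))))
  where lem : ∀ q s → - (q * s) ≡ + 0 + - q * s
        lem = solve-∀

open Algebra.Properties.Semiring.Sum (CommutativeRing.semiring ℤₚ.+-*-commutativeRing)
  using (sum; sum-cong-≗; ∑-distrib-+; ∑-comm; *-distribˡ-sum; *-distribʳ-sum)

sum-mono-≤ : ∀ {n} {f g : Fin n → ℤ} → (∀ i → f i ℤ.≤ g i) → sum f ℤ.≤ sum g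
sum-mono-≤ {zero}  f≤g = ℤₚ.≤-refl
sum-mono-≤ {suc n} f≤g = ℤₚ.+-mono-≤ (f≤g zero) (sum-mono-≤ (f≤g ∘ suc))

sum-0 : ∀ {n} {f : Fin n → ℤ} → (∀ i → f i ≡ + 0) → sum f ≡ + 0
sum-0 {zero}  f≡0 = refl
sum-0 {suc n} f≡0 = cong₂ _+_ (f≡0 zero) (sum-0 (f≡0 ∘ suc))

sum-1 : ∀ n → sum {n} (λ _ → + 1) ≡ + n
sum-1 zero    = refl
sum-1 (suc n) = cong (λ z → + 1 + z) (sum-1 n)

sum-δ : ∀ {n} (a : Fin n) → sum (FinSum.δ ℤₚ.+-*-commutativeRing a) ≡ + 1
sum-δ a = trans (sum-cong-≗ (λ x → sym (ℤₚ.*-identityʳ (δ a x)))) (⟨δ,⟩ a (λ _ → + 1))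
  where open FinSum ℤₚ.+-*-commutativeRing using (δ; ⟨δ,⟩)

-- The integral group ring modulo a prime.

module IntegralGroupRing {v : ℕ} (G : FinAbGroup v) where
  open FinAbGroup G
  open Powers G
  open GroupRing ℤₚ.+-*-commutativeRing G public
    using ( δ; δ-refl; δ-≢; δ-⇔; ⟨_,_⟩; ⟨δ,⟩; ⟨⟩-distribˡ-+; ⟨⟩-scaleˡ; push; ⟨push,⟩
          ; _⊛_; groupRing; ⊛-expand; ⊛-invariant; ⊛-scaleˡ; push-⊛; sum-translate; sum-inverse)

  -- Modulo s the s-th power of f is its image under x ↦ s · x, which is injective on the support.
  ⊛-reduced : ∀ {s d} → Prime s → Coprime s d → ∀ f → (∀ x → d · x ≢ e → f x ≡ + 0) →
              (∀ x → (f ⊛ f) x ≡ + 0 [mod s ]) → ∀ x → f x ≡ + 0 [mod s ]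
  ⊛-reduced {s} {d} s-prime s⊥d f supp f²≈0 x with (d · x) ≟ e
  ... | no d·x≢e  = S.reflexive (supp x d·x≢e)
    where module S = CommutativeRing (ℤ/ s)
  ... | yes d·x≡e = begin
    f x                         ≈⟨ M.push-injective {φ = s ·_} f x inj ⟨
    M.push (s ·_) f (s · x)     ≈⟨ M.frobenius s-prime ℤ/-char (fermat s-prime) f (s · x) ⟨
    (f M.⊛^ s) (s · x)          ≈⟨ nilpotent s s-prime (s · x) ⟩
    + 0                         ∎
    where
    module S = CommutativeRing (ℤ/ s)
    module M = GroupRing (ℤ/ s) G
    module R = CommutativeRing M.groupRing
    open import Relation.Binary.Reasoning.Setoid S.setoid
    -- A prime exponent is at least 2, so the power contains the factor f ⊛ f.
    nilpotent : ∀ t → Prime t → ∀ y → (f M.⊛^ t) y S.≈ + 0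
    nilpotent zero          t-prime = contradiction t-prime ¬prime[0]
    nilpotent (suc zero)    t-prime = contradiction t-prime ¬prime[1]
    nilpotent (suc (suc t)) t-prime y = begin
      (f M.⊛ (f M.⊛ (f M.⊛^ t))) y ≈⟨ R.*-assoc f f (f M.⊛^ t) y ⟨
      ((f M.⊛ f) M.⊛ (f M.⊛^ t)) y ≈⟨ R.*-congʳ {f M.⊛^ t} f²≈0 y ⟩
      ((λ _ → + 0) M.⊛ (f M.⊛^ t)) y ≈⟨ R.zeroˡ (f M.⊛^ t) y ⟩
      + 0 ∎
    inj : ∀ a → s · a ≡ s · x → a ≡ x ⊎ f a S.≈ + 0
    inj a s·a≡s·x with (d · a) ≟ e
    ... | no d·a≢e  = inj₂ (S.reflexive (supp a d·a≢e))
    ... | yes d·a≡e = inj₁ (·-injective s⊥d d·a≡e d·x≡e s·a≡s·x)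

-- Congruences modulo 8 and modulo powers of p.

odd⇒1+2q : ∀ {n} → ¬ 2 ℕ∣.∣ n → ∃ λ q → n ≡ 1 ℕ.+ q ℕ.* 2
odd⇒1+2q {n} 2∤n with n % 2 in eq | m%n<n n 2
... | 0 | _ = contradiction (ℕ∣.m%n≡0⇒n∣m n 2 eq) 2∤n
... | 1 | _ = n / 2 , trans (m≡m%n+[m/n]*n n 2) (cong (ℕ._+ n / 2 ℕ.* 2) eq)
... | suc (suc _) | ℕ.s≤s (ℕ.s≤s ())

q²+q-even : ∀ q → ∃ λ t → + q * + q + + q ≡ + 2 * t
q²+q-even zero    = + 0 , refl
q²+q-even (suc q) with q²+q-even q
... | t , eq = t + + 1 + + q , trans (lem (+ q)) (trans (cong (λ z → z + + 2 * (+ 1 + + q)) eq) (lem′ t (+ q)))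
  where
  lem : ∀ q → (+ 1 + q) * (+ 1 + q) + (+ 1 + q) ≡ q * q + q + + 2 * (+ 1 + q)
  lem = solve-∀
  lem′ : ∀ t q → + 2 * t + + 2 * (+ 1 + q) ≡ + 2 * (t + + 1 + q)
  lem′ = solve-∀

odd²≡1[mod8] : ∀ {n} → ¬ 2 ℕ∣.∣ n → + n * + n ≡ + 1 [mod 8 ]
odd²≡1[mod8] 2∤n with odd⇒1+2q 2∤n
... | q , refl with q²+q-even q
...   | t , eq = mod t (begin
  (+ 1 + + (q ℕ.* 2)) * (+ 1 + + (q ℕ.* 2)) ≡⟨ cong (λ z → (+ 1 + z) * (+ 1 + z)) (ℤₚ.pos-* q 2) ⟩
  (+ 1 + + q * + 2) * (+ 1 + + q * + 2)     ≡⟨ lem (+ q) ⟩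
  + 1 + + 4 * (+ q * + q + + q)             ≡⟨ cong (λ z → + 1 + + 4 * z) eq ⟩
  + 1 + + 4 * (+ 2 * t)                     ≡⟨ lem′ t ⟩
  + 1 + t * + 8                             ∎)
  where
  open ≡-Reasoning
  lem : ∀ q → (+ 1 + q * + 2) * (+ 1 + q * + 2) ≡ + 1 + + 4 * (q * q + q)
  lem = solve-∀
  lem′ : ∀ t → + 1 + + 4 * (+ 2 * t) ≡ + 1 + t * + 8
  lem′ = solve-∀

-- Binomial expansion to second order; the cofactor q of x² may remain unspecified.
[b+x]^[1+n] : ∀ b x n → ∃ λ q → (b + x) ℤ.^ suc n ≡ b ℤ.^ suc n + x * (+ suc n * b ℤ.^ n + x * q)
[b+x]^[1+n] b x zero    = + 0 , lem b x
  where lem : ∀ b x → (b + x) * + 1 ≡ b * + 1 + x * (+ 1 * + 1 + x * + 0)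
        lem = solve-∀
[b+x]^[1+n] b x (suc n) with [b+x]^[1+n] b x n
... | q , eq = b * q + + suc n * b ℤ.^ n + x * q , trans (cong (λ z → (b + x) * z) eq) (lem b x (+ suc n) (b ℤ.^ n) q)
  where lem : ∀ b x m c q → (b + x) * (b * c + x * (m * c + x * q)) ≡ b * (b * c) + x * ((+ 1 + m) * (b * c) + x * (b * q + m * c + x * q))
        lem = solve-∀

-- Let a = b + x with p d dividing x. In the expansion of a ^ p the linear term has a further factor
-- p, and x² is divisible by p² d².
^-lift : ∀ {p d a b} → .{{ℕ.NonZero p}} → + a ≡ + b [mod p ℕ.* d ] → + (a ℕ.^ p) ≡ + (b ℕ.^ p) [mod p ℕ.* (p ℕ.* d) ]
^-lift {p@(suc n)} {d} {a} {b} (mod q eq) with [b+x]^[1+n] (+ b) (q * + (p ℕ.* d)) n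
... | r , eq′ = mod (q * ((+ b) ℤ.^ n + q * + d * r)) (begin
  + (a ℕ.^ p)                                    ≡⟨ pos-^ a p ⟩
  (+ a) ℤ.^ p                                      ≡⟨ cong (ℤ._^ p) eq ⟩
  (+ b + q * + (p ℕ.* d)) ℤ.^ p                    ≡⟨ eq′ ⟩
  (+ b) ℤ.^ p + q * + (p ℕ.* d) * (+ p * (+ b) ℤ.^ n + q * + (p ℕ.* d) * r)
    ≡⟨ cong₂ (λ z w → z + q * w * (+ p * (+ b) ℤ.^ n + q * w * r)) (sym (pos-^ b p)) (ℤₚ.pos-* p d) ⟩
  + (b ℕ.^ p) + q * (+ p * + d) * (+ p * (+ b) ℤ.^ n + q * (+ p * + d) * r)
    ≡⟨ lem (+ (b ℕ.^ p)) q (+ p) (+ d) ((+ b) ℤ.^ n) r ⟩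
  + (b ℕ.^ p) + q * ((+ b) ℤ.^ n + q * + d * r) * (+ p * (+ p * + d))
    ≡⟨ cong (λ z → + (b ℕ.^ p) + q * ((+ b) ℤ.^ n + q * + d * r) * z) (trans (cong (λ z → + p * z) (sym (ℤₚ.pos-* p d))) (sym (ℤₚ.pos-* p (p ℕ.* d)))) ⟩
  + (b ℕ.^ p) + q * ((+ b) ℤ.^ n + q * + d * r) * + (p ℕ.* (p ℕ.* d)) ∎)
  where
  open ≡-Reasoning
  lem : ∀ B q p d c r → B + q * (p * d) * (p * c + q * (p * d) * r) ≡ B + q * (c + q * d * r) * (p * (p * d))
  lem = solve-∀

^-lift-iterated : ∀ {p a b} k → .{{ℕ.NonZero p}} → + a ≡ + b [mod p ] → + (a ℕ.^ p ℕ.^ k) ≡ + (b ℕ.^ p ℕ.^ k) [mod p ℕ.^ suc k ]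
^-lift-iterated {p} {a} {b} zero a≡b =
  subst (λ z → + (a ℕ.^ 1) ≡ + (b ℕ.^ 1) [mod z ]) (sym (ℕₚ.*-identityʳ p))
    (subst (λ z → + z ≡ + (b ℕ.^ 1) [mod p ]) (sym (ℕₚ.*-identityʳ a)) (subst (λ z → + a ≡ + z [mod p ]) (sym (ℕₚ.*-identityʳ b)) a≡b))
^-lift-iterated {p} {a} {b} (suc k) a≡b =
  subst (λ z → + z ≡ + (b ℕ.^ (p ℕ.* p ℕ.^ k)) [mod p ℕ.^ suc (suc k) ]) (eq a)
    (subst (λ z → + ((a ℕ.^ (p ℕ.^ k)) ℕ.^ p) ≡ + z [mod p ℕ.^ suc (suc k) ]) (eq b) (^-lift {p} {p ℕ.^ k} (^-lift-iterated k a≡b)))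
  where
  eq : ∀ m → (m ℕ.^ (p ℕ.^ k)) ℕ.^ p ≡ m ℕ.^ (p ℕ.* p ℕ.^ k)
  eq m = trans (ℕₚ.^-*-assoc m (p ℕ.^ k) p) (cong (m ℕ.^_) (ℕₚ.*-comm (p ℕ.^ k) p))

fermat-iterated : ∀ {p} → Prime p → ∀ a k → + (a ℕ.^ p ℕ.^ k) ≡ + a [mod p ]
fermat-iterated {p} p-prime a zero = S.reflexive (cong +_ (ℕₚ.*-identityʳ a))
  where module S = CommutativeRing (ℤ/ p)
fermat-iterated {p} p-prime a (suc k) = begin
  + (a ℕ.^ (p ℕ.* p ℕ.^ k))      ≡⟨ cong +_ (trans (cong (a ℕ.^_) (ℕₚ.*-comm p (p ℕ.^ k))) (sym (ℕₚ.^-*-assoc a (p ℕ.^ k) p))) ⟩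
  + ((a ℕ.^ (p ℕ.^ k)) ℕ.^ p)    ≡⟨ pos-^ˢ {p} (a ℕ.^ (p ℕ.^ k)) p ⟩
  _                              ≈⟨ fermat p-prime (+ (a ℕ.^ (p ℕ.^ k))) ⟩
  + (a ℕ.^ (p ℕ.^ k))            ≈⟨ fermat-iterated p-prime a k ⟩
  + a                            ∎
  where
  module S = CommutativeRing (ℤ/ p)
  open import Relation.Binary.Reasoning.Setoid S.setoid

mod-inverse : ∀ {p c} → Coprime p c → ∃ λ a → + (a ℕ.* c) ≡ + 1 [mod p ]
mod-inverse {p} {c} p⊥c with coprime-Bézout p⊥c
... | Bézout.-+ x y eq = y , mod (+ x) (trans (cong +_ (sym eq)) (cong (λ z → + 1 + z) (ℤₚ.pos-* x p)))
-- With this sign y c ≡ -1, so the inverse is y (y c), because its product with c is (y c)².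
... | Bézout.+- x y eq = y ℕ.* (y ℕ.* c) , S.trans (S.reflexive pos-eq) (S.trans (S.*-cong yc≡-1 yc≡-1) S.refl)
  where
  module S = CommutativeRing (ℤ/ p)
  yc≡-1 : + (y ℕ.* c) ≡ - + 1 [mod p ]
  yc≡-1 = mod (+ x) (trans (lem (+ (y ℕ.* c))) (cong (λ z → - + 1 + z) (trans (cong +_ eq) (ℤₚ.pos-* x p))))
    where lem : ∀ z → z ≡ - + 1 + (+ 1 + z)
          lem = solve-∀
  pos-eq : + (y ℕ.* (y ℕ.* c) ℕ.* c) ≡ + (y ℕ.* c) * + (y ℕ.* c)
  pos-eq = trans (cong +_ (trans (cong (ℕ._* c) (ℕₚ.*-comm y (y ℕ.* c))) (ℕₚ.*-assoc (y ℕ.* c) y c))) (ℤₚ.pos-* (y ℕ.* c) (y ℕ.* c))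

≡1⇒coprime : ∀ {a d} → + a ≡ + 1 [mod d ] → Coprime a d
≡1⇒coprime {a} {d} (mod q eq) {c} (c∣a , c∣d) = ℕ∣.∣1⇒≡1 (∣⇒∣ᵤ (subst (+ c ∣ᶻ_) lem
  (∣m∣n⇒∣m-n (∣ᵤ⇒∣ {+ c} {+ a} c∣a) (∣n⇒∣m*n q (∣ᵤ⇒∣ {+ c} {+ d} c∣d)))))
  where
  open import Data.Integer.Divisibility.Signed using (∣⇒∣ᵤ; ∣ᵤ⇒∣; ∣m∣n⇒∣m-n; ∣n⇒∣m*n) renaming (_∣_ to _∣ᶻ_)
  lem : + a - q * + d ≡ + 1
  lem = trans (cong (λ z → z - q * + d) eq) (lem′ (q * + d))
    where lem′ : ∀ z → + 1 + z - z ≡ + 1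
          lem′ = solve-∀

≡mod⇒∣∸ : ∀ {a b s} → a ℕ.≤ b → + b ≡ + a [mod s ] → s ℕ∣.∣ b ℕ.∸ a
≡mod⇒∣∸ {a} {b} {s} a≤b (mod q eq) = ≡0⇒∣ {+ (b ℕ.∸ a)} (mod q (trans b∸a (trans (cong (λ z → z - + a) eq) (lem (+ a) (q * + s)))))
  where
  b∸a : + (b ℕ.∸ a) ≡ + b - + a
  b∸a = trans (sym (ℤₚ.⊖-≥ a≤b)) (sym (ℤₚ.m-n≡m⊖n b a))
  lem : ∀ a z → a + z - a ≡ + 0 + z
  lem = solve-∀

∣∸⇒≡mod : ∀ {a b s} → a ℕ.≤ b → s ℕ∣.∣ b ℕ.∸ a → + b ≡ + a [mod s ]
∣∸⇒≡mod {a} {b} {s} a≤b (ℕ∣.divides q eq) = mod (+ q) (trans (cong +_ (trans (sym (ℕₚ.m+[n∸m]≡n a≤b)) (cong (a ℕ.+_) eq))) (cong (λ z → + a + z) (ℤₚ.pos-* q s)))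

-- The Sylow subgroups of an Abelian group of order 8p³

module Sylow {v p : ℕ} (v≡8p³ : v ≡ 8 ℕ.* p ℕ.^ 3) (p-prime : Prime p) (2<p : 2 ℕ.< p) (G : FinAbGroup v) where
  open FinAbGroup G
  open Powers G
  open IntegralGroupRing G

  2∤p : ¬ 2 ℕ∣.∣ p
  2∤p 2∣p with prime⇒irreducible p-prime 2∣p
  ... | inj₁ ()
  ... | inj₂ refl = ℕₚ.<-irrefl refl 2<p

  p∤2^ : ∀ k → ¬ p ℕ∣.∣ 2 ℕ.^ k
  p∤2^ k p∣2^k = ℕₚ.<⇒≢ (ℕₚ.<-trans (ℕₚ.n<1+n 1) 2<p)
    (sym (coprime-^ k (Coprimality.sym (prime∤⇒coprime prime[2] 2∤p)) (ℕ∣.∣-refl , p∣2^k)))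

  p⊥8 : Coprime p 8
  p⊥8 = prime∤⇒coprime p-prime (p∤2^ 3)

  -- The exponent must be at least 3, to kill the p-part, and even, to make the power 1 modulo 8.
  -- Hence p⁴, which gives an idempotent endomorphism with the Sylow 2-subgroup N as image and P as
  -- kernel.
  φ : Fin v → Fin v
  φ x = (p ℕ.^ 4) · x

  φ-homo : ∀ a b → φ (a ∙ b) ≡ φ a ∙ φ b
  φ-homo a b = ·-distrib-∙ a b (p ℕ.^ 4)

  φ-e : φ e ≡ e
  φ-e = ·-e (p ℕ.^ 4)

  p⁴≡1[mod8] : + (p ℕ.^ 4) ≡ + 1 [mod 8 ]
  p⁴≡1[mod8] = S.trans (S.reflexive (trans (pos-^ p 4) (lem (+ p)))) (S.*-cong p²≡1 p²≡1)
    where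
    module S = CommutativeRing (ℤ/ 8)
    p²≡1 = odd²≡1[mod8] 2∤p
    lem : ∀ p → p * (p * (p * (p * + 1))) ≡ (p * p) * (p * p)
    lem = solve-∀

  8·x≡e⇒φx≡x : ∀ {x} → 8 · x ≡ e → φ x ≡ x
  8·x≡e⇒φx≡x {x} 8·x≡e = trans (·-mod 8·x≡e p⁴≡1[mod8]) (G.identityʳ x)

  8p³·x≡e : ∀ x → (8 ℕ.* p ℕ.^ 3) · x ≡ e
  8p³·x≡e x = subst (λ n → n · x ≡ e) v≡8p³ (v·x≡e x)

  8·φx≡e : ∀ x → 8 · φ x ≡ e
  8·φx≡e x = begin
    8 · φ x                     ≡⟨ ·-assocˡ x 8 (p ℕ.^ 4) ⟩
    (8 ℕ.* (p ℕ.* p ℕ.^ 3)) · x ≡⟨ cong (_· x) (x∙yz≈y∙xz 8 p (p ℕ.^ 3)) ⟩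
    (p ℕ.* (8 ℕ.* p ℕ.^ 3)) · x ≡⟨ multiple-·≡e p (8p³·x≡e x) ⟩
    e                           ∎
    where
    open ≡-Reasoning
    open import Algebra.Properties.CommutativeSemigroup ℕₚ.*-commutativeSemigroup using (x∙yz≈y∙xz)

  φ-idem : ∀ x → φ (φ x) ≡ φ x
  φ-idem x = 8·x≡e⇒φx≡x (8·φx≡e x)

  φx≡e⇒p³·x≡e : ∀ {x} → φ x ≡ e → (p ℕ.^ 3) · x ≡ e
  φx≡e⇒p³·x≡e {x} φx≡e = ·-coprime p⊥8 (trans (·-assocˡ x p (p ℕ.^ 3)) φx≡e) (trans (·-assocˡ x 8 (p ℕ.^ 3)) (8p³·x≡e x))

  -- As φ is idempotent, its image N is the set of its fixed points; this makes membership in N a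
  -- decidable equation.
  𝟏 1N 1P : Fin v → ℤ
  𝟏 _  = + 1
  1N x = δ (φ x) x
  1P x = δ (φ x) e

  ∣N∣ ∣P∣ : ℤ
  ∣N∣ = sum 1N
  ∣P∣ = sum 1P

  -- The fibre of φ over a point x of N is the coset xP, and translation by x carries P onto it;
  -- outside N the fibres are empty.
  push-𝟏 : ∀ x → push φ 𝟏 x ≡ ∣P∣ * 1N x
  push-𝟏 x with φ x ≟ x
  ... | yes φx≡x = begin
    sum (λ a → + 1 * δ (φ a) x)     ≡⟨ sum-cong-≗ (λ a → ℤₚ.*-identityˡ (δ (φ a) x)) ⟩
    sum (λ a → δ (φ a) x)           ≡⟨ sum-translate x (λ a → δ (φ a) x) ⟨
    sum (λ a → δ (φ (x ∙ a)) x)     ≡⟨ sum-cong-≗ (λ a → δ-⇔ {a = φ (x ∙ a)} {x} {φ a} {e} (to a) (from a)) ⟩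
    ∣P∣                             ≡⟨ ℤₚ.*-identityʳ ∣P∣ ⟨
    ∣P∣ * + 1                       ∎
    where
    open ≡-Reasoning
    φ[xa] : ∀ a → φ (x ∙ a) ≡ x ∙ φ a
    φ[xa] a = trans (φ-homo x a) (cong (_∙ φ a) φx≡x)
    to : ∀ a → φ (x ∙ a) ≡ x → φ a ≡ e
    to a eq = identityʳ-unique x (φ a) (trans (sym (φ[xa] a)) eq)
    from : ∀ a → φ a ≡ e → φ (x ∙ a) ≡ x
    from a eq = trans (φ[xa] a) (trans (cong (x ∙_) eq) (G.identityʳ x))
  ... | no φx≢x = trans (sum-0 {f = λ a → + 1 * δ (φ a) x} (λ a → trans (ℤₚ.*-identityˡ _) (δ-≢ {a = φ a} (λ { refl → φx≢x (φ-idem a) })))) (sym (ℤₚ.*-zeroʳ ∣P∣))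

  ∣P∣∣N∣≡8p³ : ∣P∣ * ∣N∣ ≡ + (8 ℕ.* p ℕ.^ 3)
  ∣P∣∣N∣≡8p³ = begin
    ∣P∣ * ∣N∣               ≡⟨ *-distribˡ-sum ∣P∣ 1N ⟩
    sum (λ x → ∣P∣ * 1N x)  ≡⟨ sum-cong-≗ push-𝟏 ⟨
    sum (push φ 𝟏)          ≡⟨ sum-cong-≗ (λ x → ℤₚ.*-identityʳ (push φ 𝟏 x)) ⟨
    ⟨ push φ 𝟏 , 𝟏 ⟩        ≡⟨ ⟨push,⟩ φ 𝟏 𝟏 ⟩
    ⟨ 𝟏 , 𝟏 ⟩               ≡⟨ sum-1 v ⟩
    + v                     ≡⟨ cong +_ v≡8p³ ⟩
    + (8 ℕ.* p ℕ.^ 3)       ∎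
    where open ≡-Reasoning

  1N-supp : ∀ x → 8 · x ≢ e → 1N x ≡ + 0
  1N-supp x 8·x≢e = δ-≢ {a = φ x} (λ φx≡x → 8·x≢e (subst (λ z → 8 · z ≡ e) φx≡x (8·φx≡e x)))

  1P-supp : ∀ x → (p ℕ.^ 3) · x ≢ e → 1P x ≡ + 0
  1P-supp x p³·x≢e = δ-≢ {a = φ x} (p³·x≢e ∘ φx≡e⇒p³·x≡e)

  1N-invariant : ∀ {a} → φ a ≡ a → ∀ x → 1N (inv a ∙ x) ≡ 1N x
  1N-invariant {a} φa≡a x = δ-⇔ {a = φ (inv a ∙ x)} {inv a ∙ x} {φ x} {x}
    (λ eq → ∙-cancelˡ (inv a) (φ x) x (trans (sym shift) eq)) (λ eq → trans shift (cong (inv a ∙_) eq))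
    where
    shift : φ (inv a ∙ x) ≡ inv a ∙ φ x
    shift = trans (φ-homo (inv a) x) (cong (_∙ φ x) (trans (·-inverse (p ℕ.^ 4) a) (cong inv φa≡a)))

  1P-invariant : ∀ {a} → φ a ≡ e → ∀ x → 1P (inv a ∙ x) ≡ 1P x
  1P-invariant {a} φa≡e x = cong (λ z → δ z e) (begin
    φ (inv a ∙ x)     ≡⟨ φ-homo (inv a) x ⟩
    φ (inv a) ∙ φ x   ≡⟨ cong (_∙ φ x) (trans (·-inverse (p ℕ.^ 4) a) (cong inv φa≡e)) ⟩
    inv e ∙ φ x       ≡⟨ cong (inv e ∙_) (sym (G.identityˡ (φ x))) ⟩
    inv e ∙ (e ∙ φ x) ≡⟨ inv-∙-cancelˡ e (φ x) ⟩
    φ x               ∎)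
    where open ≡-Reasoning

  1N⊛1N : ∀ x → (1N ⊛ 1N) x ≡ ∣N∣ * 1N x
  1N⊛1N = ⊛-invariant 1N 1N inv-or-0
    where
    inv-or-0 : ∀ a → 1N a ≡ + 0 ⊎ (∀ x → 1N (inv a ∙ x) ≡ 1N x)
    inv-or-0 a with φ a ≟ a
    ... | yes φa≡a = inj₂ (1N-invariant φa≡a)
    ... | no _     = inj₁ refl

  1P⊛1P : ∀ x → (1P ⊛ 1P) x ≡ ∣P∣ * 1P x
  1P⊛1P = ⊛-invariant 1P 1P inv-or-0
    where
    inv-or-0 : ∀ a → 1P a ≡ + 0 ⊎ (∀ x → 1P (inv a ∙ x) ≡ 1P x)
    inv-or-0 a with φ a ≟ e
    ... | yes φa≡e = inj₂ (1P-invariant φa≡e)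
    ... | no _     = inj₁ refl

  -- If s divided Σχ, then χ would be nilpotent modulo s.
  prime∤sum : ∀ {s d} (χ : Fin v → ℤ) → Prime s → Coprime s d → (∀ x → d · x ≢ e → χ x ≡ + 0) →
              (∀ x → (χ ⊛ χ) x ≡ sum χ * χ x) → χ e ≡ + 1 → ¬ s ℕ∣.∣ ℤ.∣ sum χ ∣
  prime∤sum {s} χ s-prime s⊥d supp χ² χe≡1 s∣Σχ = ¬prime[1] (subst Prime (ℕ∣.∣1⇒≡1 s∣1) s-prime)
    where
    module S = CommutativeRing (ℤ/ s)
    s∣1 : s ℕ∣.∣ 1
    s∣1 = subst (λ z → s ℕ∣.∣ ℤ.∣ z ∣) χe≡1 (≡0⇒∣ (⊛-reduced s-prime s⊥d χ supp
      (λ x → S.trans (S.reflexive (χ² x)) (S.trans (S.*-cong {sum χ} {+ 0} {χ x} {χ x} (∣⇒≡0 s∣Σχ) S.refl) (S.reflexive (ℤₚ.*-zeroˡ (χ x))))) e))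

  sum-δ≥0 : (f g : Fin v → Fin v) → + 0 ℤ.≤ sum (λ x → δ (f x) (g x))
  sum-δ≥0 f g = subst (ℤ._≤ sum (λ x → δ (f x) (g x))) (sum-0 {f = λ (_ : Fin v) → + 0} (λ _ → refl)) (sum-mono-≤ 0≤δ)
    where
    0≤δ : ∀ x → + 0 ℤ.≤ δ (f x) (g x)
    0≤δ x with f x ≟ g x
    ... | yes _ = ℤ.+≤+ ℕ.z≤n
    ... | no _  = ℤ.+≤+ ℕ.z≤n

  private
    n′ p′ : ℕ
    n′ = ℤ.∣ ∣N∣ ∣
    p′ = ℤ.∣ ∣P∣ ∣
    p′n′≡8p³ : p′ ℕ.* n′ ≡ 8 ℕ.* p ℕ.^ 3
    p′n′≡8p³ = trans (sym (ℤₚ.abs-* ∣P∣ ∣N∣)) (cong ℤ.∣_∣ ∣P∣∣N∣≡8p³)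
    1e : δ (φ e) e ≡ + 1
    1e = trans (cong (λ z → δ z e) φ-e) (δ-refl e)
    -- The support of `1N` is 8-torsion and that of `1P` is p³-torsion, so nilpotence modulo p and
    -- modulo 2 excludes p from |N| and 2 from |P|. As the product is 8p³, this determines both
    -- orders.
    n′⊥p³ : Coprime n′ (p ℕ.^ 3)
    n′⊥p³ = coprime-^ 3 (Coprimality.sym (prime∤⇒coprime p-prime (prime∤sum 1N p-prime p⊥8 1N-supp 1N⊛1N 1e)))
    p′⊥8 : Coprime p′ 8
    p′⊥8 = coprime-^ 3 (Coprimality.sym (prime∤⇒coprime prime[2] (prime∤sum 1P prime[2] (coprime-^ 3 (prime∤⇒coprime prime[2] 2∤p)) 1P-supp 1P⊛1P 1e)))
    n′∣8 : n′ ℕ∣.∣ 8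
    n′∣8 = coprime-divisor n′⊥p³ (ℕ∣.divides p′ (trans (ℕₚ.*-comm (p ℕ.^ 3) 8) (sym p′n′≡8p³)))
    p′∣p³ : p′ ℕ∣.∣ p ℕ.^ 3
    p′∣p³ = coprime-divisor p′⊥8 (ℕ∣.divides n′ (trans (sym p′n′≡8p³) (ℕₚ.*-comm p′ n′)))
    instance
      p≢0 : ℕ.NonZero p
      p≢0 = prime⇒nonZero p-prime
      p³≢0 : ℕ.NonZero (p ℕ.^ 3)
      p³≢0 = ℕₚ.m^n≢0 p 3
    n′≡8 : n′ ≡ 8
    n′≡8 = ℕₚ.≤-antisym (ℕ∣.∣⇒≤ n′∣8) (ℕₚ.*-cancelˡ-≤ (p ℕ.^ 3) (begin
      p ℕ.^ 3 ℕ.* 8 ≡⟨ ℕₚ.*-comm (p ℕ.^ 3) 8 ⟩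
      8 ℕ.* p ℕ.^ 3 ≡⟨ p′n′≡8p³ ⟨
      p′ ℕ.* n′ ≤⟨ ℕₚ.*-monoˡ-≤ n′ (ℕ∣.∣⇒≤ p′∣p³) ⟩
      p ℕ.^ 3 ℕ.* n′ ∎))
      where open ℕₚ.≤-Reasoning
    p′≡p³ : p′ ≡ p ℕ.^ 3
    p′≡p³ = ℕₚ.*-cancelʳ-≡ p′ (p ℕ.^ 3) 8 (trans (subst (λ n → p′ ℕ.* n ≡ 8 ℕ.* p ℕ.^ 3) n′≡8 p′n′≡8p³) (ℕₚ.*-comm 8 (p ℕ.^ 3)))

  ∣N∣≡8 : ∣N∣ ≡ + 8
  ∣N∣≡8 = trans (sym (ℤₚ.0≤i⇒+∣i∣≡i (sum-δ≥0 φ (λ x → x)))) (cong +_ n′≡8)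

  ∣P∣≡p³ : ∣P∣ ≡ + (p ℕ.^ 3)
  ∣P∣≡p³ = trans (sym (ℤₚ.0≤i⇒+∣i∣≡i (sum-δ≥0 φ (λ _ → e)))) (cong +_ p′≡p³)

-- Teichmüller units and their free action on the Sylow p-subgroup.

module Teichmüller {v p : ℕ} (v≡8p³ : v ≡ 8 ℕ.* p ℕ.^ 3) (p-prime : Prime p) (2<p : 2 ℕ.< p) (G : FinAbGroup v) where
  open FinAbGroup G
  open Powers G
  open Sylow v≡8p³ p-prime 2<p G
  private
    module S = CommutativeRing (ℤ/ p)
    instance
      p≢0 : ℕ.NonZero p
      p≢0 = prime⇒nonZero p-prime

  -- The Teichmüller representative: τ a ≡ a modulo p by Fermat, while modulo p³ it depends only on
  -- a modulo p, since each p-th power gains one factor p in the modulus.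
  τ : ℕ → ℕ
  τ a = a ℕ.^ p ℕ.^ 2

  τ-* : ∀ a b → τ (a ℕ.* b) ≡ τ a ℕ.* τ b
  τ-* a b = ^-distribʳ-* (p ℕ.^ 2)
    where
    open import Algebra.Properties.CommutativeSemigroup ℕₚ.*-commutativeSemigroup using (interchange)
    ^-distribʳ-* : ∀ n → (a ℕ.* b) ℕ.^ n ≡ a ℕ.^ n ℕ.* b ℕ.^ n
    ^-distribʳ-* zero    = refl
    ^-distribʳ-* (suc n) = trans (cong (a ℕ.* b ℕ.*_) (^-distribʳ-* n)) (interchange a b (a ℕ.^ n) (b ℕ.^ n))

  τ-cong : ∀ {a b x} → (p ℕ.^ 3) · x ≡ e → + a ≡ + b [mod p ] → τ a · x ≡ τ b · x
  τ-cong p³·x≡e a≡b = ·-mod p³·x≡e (^-lift-iterated 2 a≡b)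

  τ-coprime : ∀ {a} → ¬ p ℕ∣.∣ a → Coprime (τ a) (p ℕ.^ 3)
  τ-coprime p∤a = Coprimality.sym (coprime-^ (p ℕ.^ 2) (Coprimality.sym (coprime-^ 3 (Coprimality.sym (prime∤⇒coprime p-prime p∤a)))))

  unit : Fin (p ℕ.∸ 1) → ℕ
  unit i = suc (toℕ i)

  unit<p : ∀ i → unit i ℕ.< p
  unit<p i = subst (unit i ℕ.<_) (ℕₚ.suc-pred p) (ℕ.s≤s (toℕ<n i))

  p∤unit : ∀ i → ¬ p ℕ∣.∣ unit i
  p∤unit i p∣i = ℕₚ.<⇒≱ (unit<p i) (ℕ∣.∣⇒≤ p∣i)

  unit-surjective : ∀ {a} → ¬ p ℕ∣.∣ a → ∃ λ i → + unit i ≡ + a [mod p ]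
  unit-surjective {a} p∤a with a % p in eq | m%n<n a p
  ... | zero  | _    = contradiction (ℕ∣.m%n≡0⇒n∣m a p eq) p∤a
  ... | suc r | r<p  = fromℕ< r<p-1 , S.sym (mod (+ (a / p)) (trans (cong +_ (m≡m%n+[m/n]*n a p))
                         (cong₂ (λ z w → + z + w) (trans eq (cong suc (sym (toℕ-fromℕ< r<p-1)))) (ℤₚ.pos-* (a / p) p))))
    where
    r<p-1 : r ℕ.< p ℕ.∸ 1
    r<p-1 = ℕ.s≤s⁻¹ (subst (suc r ℕ.<_) (sym (ℕₚ.suc-pred p)) r<p)

  act : Fin (p ℕ.∸ 1) → Fin v → Fin v
  act i x = τ (unit i) · x

  P\e : Fin v → Set
  P\e x = (p ℕ.^ 3) · x ≡ e × x ≢ e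

  ·-comm-· : ∀ m n x → m · (n · x) ≡ n · (m · x)
  ·-comm-· m n x = trans (·-assocˡ x m n) (trans (cong (_· x) (ℕₚ.*-comm m n)) (sym (·-assocˡ x n m)))

  act-act : ∀ i j x → act j (act i x) ≡ τ (unit j ℕ.* unit i) · x
  act-act i j x = trans (·-assocˡ x (τ (unit j)) (τ (unit i))) (cong (_· x) (sym (τ-* (unit j) (unit i))))

  τ-1 : ∀ x → τ 1 · x ≡ x
  τ-1 x = trans (cong (_· x) (ℕₚ.^-zeroˡ (p ℕ.^ 2))) (G.identityʳ x)

  p∤1 : ¬ p ℕ∣.∣ 1
  p∤1 p∣1 = ¬prime[1] (subst Prime (ℕ∣.∣1⇒≡1 p∣1) p-prime)

  act-refl : ∀ {x} → P\e x → ∃ λ i → act i x ≡ x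
  act-refl {x} (p³·x≡e , _) = let (i , eq) = unit-surjective p∤1 in i , trans (τ-cong p³·x≡e eq) (τ-1 x)

  act-sym : ∀ {x} → P\e x → ∀ i → ∃ λ j → act j (act i x) ≡ x
  act-sym {x} (p³·x≡e , _) i = j , trans (act-act i j x) (trans (τ-cong p³·x≡e ji≡1) (τ-1 x))
    where
    inverse = mod-inverse (prime∤⇒coprime p-prime (p∤unit i))
    a = proj₁ inverse
    p∤a : ¬ p ℕ∣.∣ a
    p∤a p∣a = p∤1 (≡0⇒∣ {+ 1} (S.trans (S.sym (proj₂ inverse)) (∣⇒≡0 {+ (a ℕ.* unit i)} (ℕ∣.∣m⇒∣m*n (unit i) p∣a))))
    j = proj₁ (unit-surjective p∤a)
    ji≡1 : + (unit j ℕ.* unit i) ≡ + 1 [mod p ]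
    ji≡1 = S.trans (S.reflexive (ℤₚ.pos-* (unit j) (unit i))) (S.trans (S.*-congʳ {+ unit i} (proj₂ (unit-surjective p∤a)))
      (S.trans (S.reflexive (sym (ℤₚ.pos-* a (unit i)))) (proj₂ inverse)))

  act-trans : ∀ {x} → P\e x → ∀ i j → ∃ λ l → act l x ≡ act j (act i x)
  act-trans {x} (p³·x≡e , _) i j = let (l , eq) = unit-surjective p∤ji in l , trans (τ-cong p³·x≡e eq) (sym (act-act i j x))
    where
    p∤ji : ¬ p ℕ∣.∣ unit j ℕ.* unit i
    p∤ji p∣ji with euclidsLemma (unit j) (unit i) p-prime p∣ji
    ... | inj₁ p∣j = p∤unit j p∣j
    ... | inj₂ p∣i = p∤unit i p∣i

  act-closed : ∀ {x} → P\e x → ∀ i → P\e (act i x)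
  act-closed {x} (p³·x≡e , x≢e) i =
    trans (·-comm-· (p ℕ.^ 3) (τ (unit i)) x) (trans (cong (τ (unit i) ·_) p³·x≡e) (·-e (τ (unit i)))) ,
    (λ act≡e → x≢e (·-coprime (τ-coprime (p∤unit i)) act≡e p³·x≡e))

  private
    -- The difference d of the two multipliers kills x. Modulo p it is the difference of two
    -- distinct units below p, so d is prime to p, and x of order dividing p³ would be e.
    act-free-< : ∀ {x} → P\e x → ∀ {i j} → toℕ i ℕ.< toℕ j → act i x ≢ act j x
    act-free-< {x} (p³·x≡e , x≢e) {i} {j} i<j eq = x≢e (·-coprime (coprime-^ 3 (Coprimality.sym (prime∤⇒coprime p-prime p∤d))) d·x≡e p³·x≡e)
      where
      τi≤τj : τ (unit i) ℕ.≤ τ (unit j)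
      τi≤τj = ℕₚ.^-monoˡ-≤ (p ℕ.^ 2) (ℕ.s≤s (ℕₚ.<⇒≤ i<j))
      d = τ (unit j) ℕ.∸ τ (unit i)
      d·x≡e : d · x ≡ e
      d·x≡e = identityʳ-unique (act i x) (d · x) (trans (sym (·-homo-+ x (τ (unit i)) d)) (trans (cong (_· x) (ℕₚ.m+[n∸m]≡n τi≤τj)) (sym eq)))
      p∤d : ¬ p ℕ∣.∣ d
      p∤d p∣d = ℕₚ.<⇒≱ (ℕₚ.≤-<-trans (ℕₚ.m∸n≤m (toℕ j) (toℕ i)) (ℕₚ.<-trans (ℕₚ.n<1+n (toℕ j)) (unit<p j)))
        (ℕ∣.∣⇒≤ {{ℕ.>-nonZero (ℕₚ.m<n⇒0<n∸m i<j)}} (≡mod⇒∣∸ (ℕ.s≤s (ℕₚ.<⇒≤ i<j))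
          (S.trans (S.sym (fermat-iterated p-prime (unit j) 2)) (S.trans (∣∸⇒≡mod τi≤τj p∣d) (fermat-iterated p-prime (unit i) 2)))))

  act-free : ∀ {x} → P\e x → ∀ {i j} → act i x ≡ act j x → i ≡ j
  act-free Tx {i} {j} eq with ℕₚ.<-cmp (toℕ i) (toℕ j)
  ... | tri< i<j _ _ = contradiction eq (act-free-< Tx i<j)
  ... | tri≈ _ i≡j _ = toℕ-injective i≡j
  ... | tri> _ _ j<i = contradiction (sym eq) (act-free-< Tx j<i)

-- Orbits of a free action

-- The least index at which f holds, with d as the default where the search stops. If f d is true,
-- the result does not depend on d, so it is a canonical representative of the class with
-- characteristic function f.
first : ∀ {n} → (Fin n → Bool) → Fin n → Fin n
first f zero    = zero
first f (suc d) = if f zero then zero else suc (first (f ∘ suc) d)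

first-true : ∀ {n} (f : Fin n → Bool) d → f d ≡ true → f (first f d) ≡ true
first-true f zero    fd = fd
first-true f (suc d) fd with f zero in f0
... | true  = f0
... | false = first-true (f ∘ suc) d fd

first-unique : ∀ {n} (f g : Fin n → Bool) {d d′} → (∀ x → f x ≡ g x) → f d ≡ true → g d′ ≡ true → first f d ≡ first g d′
first-unique f g {zero}  {zero}   f≗g fd gd′ = refl
first-unique f g {zero}  {suc d′} f≗g fd gd′ rewrite trans (sym (f≗g zero)) fd = refl
first-unique f g {suc d} {zero}   f≗g fd gd′ rewrite trans (f≗g zero) gd′ = refl
first-unique f g {suc d} {suc d′} f≗g fd gd′ rewrite f≗g zero with g zero
... | true  = refl
... | false = cong suc (first-unique (f ∘ suc) (g ∘ suc) (f≗g ∘ suc) fd gd′)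

does-true : ∀ {a} {A : Set a} (d : Dec A) → does d ≡ true → A
does-true (yes a) _ = a

module _ {v : ℕ} where
  open FinSum ℤₚ.+-*-commutativeRing using (δ; δ-≢; δ-⇔; ⟨δ,⟩)
  open ≡-Reasoning

  sum-δ-injective : ∀ {d} (f : Fin d → Fin v) → (∀ {i j} → f i ≡ f j → i ≡ j) → ∀ y →
                    sum (λ i → δ (f i) y) ≡ (if does (any? (λ i → f i ≟ y)) then + 1 else + 0)
  sum-δ-injective f inj y with any? (λ i → f i ≟ y)
  ... | yes (i , refl) = trans (sum-cong-≗ (λ j → δ-⇔ {a = f j} {f i} {i} {j} (sym ∘ inj) (cong f ∘ sym))) (sum-δ i)
  ... | no ∄i          = sum-0 (λ i → δ-≢ {a = f i} (λ eq → ∄i (i , eq)))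

  -- The index set carries no group structure: a product of two units has to be reduced modulo p
  -- before it is a unit again. So the orbit laws only assert that some index exists. Together with
  -- `free` they say that each class in T is listed by m exactly once, hence has d elements.
  module Orbits {d : ℕ} (m : Fin d → Fin v → Fin v) (T : Fin v → Set) (w : Fin v → ℤ)
    (orbit-refl   : ∀ {x} → T x → ∃ λ i → m i x ≡ x)
    (orbit-sym    : ∀ {x} → T x → ∀ i → ∃ λ j → m j (m i x) ≡ x)
    (orbit-trans  : ∀ {x} → T x → ∀ i j → ∃ λ l → m l x ≡ m j (m i x))
    (free         : ∀ {x} → T x → ∀ {i j} → m i x ≡ m j x → i ≡ j)
    (T-closed     : ∀ {x} → T x → ∀ i → T (m i x))
    (w-invariant  : ∀ {x} → T x → ∀ i → w (m i x) ≡ w x)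
    (w-supported  : ∀ x → w x ≡ + 0 ⊎ T x) where

    _∼?_ : ∀ x y → Dec (∃ λ i → m i x ≡ y)
    x ∼? y = any? (λ i → m i x ≟ y)

    rep : Fin v → Fin v
    rep x = first (λ y → does (x ∼? y)) x

    rep-∼ : ∀ {x} → T x → ∃ λ i → m i x ≡ rep x
    rep-∼ {x} Tx = does-true (x ∼? rep x) (first-true (λ y → does (x ∼? y)) x (dec-true (x ∼? x) (orbit-refl Tx)))

    rep-cong : ∀ {x} → T x → ∀ i → rep (m i x) ≡ rep x
    rep-cong {x} Tx i = first-unique (λ y → does (m i x ∼? y)) (λ y → does (x ∼? y))
      (λ y → does-⇔ (mk⇔
        (λ { (j , refl) → orbit-trans Tx i j })
        (λ { (j , refl) → let (l , eq) = orbit-sym Tx i; (n , eq′) = orbit-trans (T-closed Tx i) l j in n , trans eq′ (cong (m j) eq) }))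
        (m i x ∼? y) (x ∼? y))
      (dec-true (m i x ∼? m i x) (orbit-refl (T-closed Tx i))) (dec-true (x ∼? x) (orbit-refl Tx))

    fibre : Fin v → ℤ
    fibre c = sum (λ x → δ (rep x) c * w x)

    fibre≡0 : ∀ c → (∀ {x} → T x → rep x ≡ c → w x ≡ + 0) → fibre c ≡ + 0
    fibre≡0 c zero-on = sum-0 term
      where
      term : ∀ x → δ (rep x) c * w x ≡ + 0
      term x with w-supported x
      ... | inj₁ wx≡0 = trans (cong (λ z → δ (rep x) c * z) wx≡0) (ℤₚ.*-zeroʳ (δ (rep x) c))
      ... | inj₂ Tx with rep x ≟ c
      ...   | yes eq = trans (ℤₚ.*-identityˡ (w x)) (zero-on Tx eq)
      ...   | no _   = refl

    fibre-rep : ∀ c → T c → rep c ≡ c → fibre c ≡ w c * + d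
    fibre-rep c Tc rep-c = begin
      sum (λ x → δ (rep x) c * w x)                  ≡⟨ sum-cong-≗ term ⟩
      sum (λ x → sum (λ i → δ (m i c) x * w x))      ≡⟨ ∑-comm (λ x i → δ (m i c) x * w x) ⟩
      sum (λ i → sum (λ x → δ (m i c) x * w x))      ≡⟨ sum-cong-≗ (λ i → trans (⟨δ,⟩ (m i c) w) (w-invariant Tc i)) ⟩
      sum {d} (λ _ → w c)                            ≡⟨ sum-cong-≗ {d} (λ _ → sym (ℤₚ.*-identityʳ (w c))) ⟩
      sum {d} (λ _ → w c * + 1)                      ≡⟨ *-distribˡ-sum {d} (w c) (λ _ → + 1) ⟨
      w c * sum {d} (λ _ → + 1)                      ≡⟨ cong (λ z → w c * z) (sum-1 d) ⟩
      w c * + d                                      ∎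
      where
      -- On T, x has representative c exactly when it is some `m i c`, and by freeness for one i
      -- only.
      term : ∀ x → δ (rep x) c * w x ≡ sum (λ i → δ (m i c) x * w x)
      term x = trans term′ (*-distribʳ-sum (w x) (λ i → δ (m i c) x))
        where
        term′ : δ (rep x) c * w x ≡ sum (λ i → δ (m i c) x) * w x
        term′ with w-supported x
        ... | inj₁ wx≡0 = trans (trans (cong (λ z → δ (rep x) c * z) wx≡0) (ℤₚ.*-zeroʳ (δ (rep x) c)))
                            (sym (trans (cong (λ z → sum (λ i → δ (m i c) x) * z) wx≡0) (ℤₚ.*-zeroʳ (sum (λ i → δ (m i c) x)))))
        ... | inj₂ Tx = cong (λ z → z * w x) (trans
          (cong (λ t → if t then + 1 else + 0) (does-⇔ (mk⇔
            (λ { refl → let (i , eq) = rep-∼ Tx; (j , eq′) = orbit-sym Tx i in j , trans (cong (m j) (sym eq)) eq′ })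
            (λ { (i , refl) → trans (rep-cong Tc i) rep-c })) (rep x ≟ c) (c ∼? x)))
          (sym (sum-δ-injective (λ i → m i c) (free Tc) x)))

    -- A point c of T that is its own representative carries a whole orbit, with d equal weights. If
    -- c is not its own representative, no point of T is sent to it.
    d∣fibre : ∀ c → ∃ λ q → fibre c ≡ q * + d
    d∣fibre c with w-supported c
    ... | inj₁ wc≡0 = + 0 , trans (fibre≡0 c (λ { Tx refl → let (i , eq) = rep-∼ Tx in trans (sym (w-invariant Tx i)) (trans (cong w eq) wc≡0) })) (sym (ℤₚ.*-zeroˡ (+ d)))
    ... | inj₂ Tc with rep c ≟ c
    ...   | yes rep-c = w c , fibre-rep c Tc rep-c
    ...   | no rep-c≢ = + 0 , trans (fibre≡0 c (λ { Tx refl → contradiction (let (i , eq) = rep-∼ Tx in trans (cong rep (sym eq)) (rep-cong Tx i)) rep-c≢ })) (sym (ℤₚ.*-zeroˡ (+ d)))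

    d∣sum : ∃ λ q → sum w ≡ q * + d
    d∣sum = sum (λ c → proj₁ (d∣fibre c)) , (begin
      sum w                                        ≡⟨ sum-cong-≗ (λ x → trans (sym (ℤₚ.*-identityˡ (w x))) (cong (λ z → z * w x) (sym (sum-δ (rep x))))) ⟩
      sum (λ x → sum (δ (rep x)) * w x)            ≡⟨ sum-cong-≗ (λ x → *-distribʳ-sum (w x) (δ (rep x))) ⟩
      sum (λ x → sum (λ c → δ (rep x) c * w x))    ≡⟨ ∑-comm (λ x c → δ (rep x) c * w x) ⟩
      sum fibre                                    ≡⟨ sum-cong-≗ (λ c → proj₂ (d∣fibre c)) ⟩
      sum (λ c → proj₁ (d∣fibre c) * + d)          ≡⟨ *-distribʳ-sum (+ d) (λ c → proj₁ (d∣fibre c)) ⟨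
      sum (λ c → proj₁ (d∣fibre c)) * + d          ∎)

-- Regular partial difference sets

[_]? : ∀ {a} {A : Set a} → Dec A → ℤ
[ d ]? = if does d then + 1 else + 0

length-filter-tabulate : ∀ {a p} {A : Set a} {P : Pred A p} (P? : Decidable P) {n} (f : Fin n → A) →
                         + length (filter P? (tabulate f)) ≡ sum (λ i → [ P? (f i) ]?)
length-filter-tabulate P? {zero}  f = refl
length-filter-tabulate P? {suc n} f with does (P? (f zero))
... | true  = cong (λ z → + 1 + z) (length-filter-tabulate P? (f ∘ suc))
... | false = trans (length-filter-tabulate P? (f ∘ suc)) (sym (ℤₚ.+-identityˡ _))

length-filter-cartesianProduct : ∀ {a b p} {A : Set a} {B : Set b} {P : Pred (A × B) p} (P? : Decidable P) {m n} (f : Fin m → A) (g : Fin n → B) →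
  + length (filter P? (cartesianProduct (tabulate f) (tabulate g))) ≡ sum (λ i → sum (λ j → [ P? (f i , g j) ]?))
length-filter-cartesianProduct P? {zero}  f g = refl
length-filter-cartesianProduct P? {suc m} f g = begin
  + length (filter P? (row ++ rest))                         ≡⟨ cong (λ l → + length l) (filter-++ P? row rest) ⟩
  + length (filter P? row ++ filter P? rest)                 ≡⟨ cong +_ (length-++ (filter P? row)) ⟩
  + length (filter P? row) + + length (filter P? rest)       ≡⟨ cong₂ _+_ (trans (cong (λ l → + length (filter P? l)) (map-tabulate g (f zero ,_)))
                                                                                (length-filter-tabulate P? (λ j → f zero , g j)))
                                                                         (length-filter-cartesianProduct P? (f ∘ suc) g) ⟩
  sum (λ i → sum (λ j → [ P? (f i , g j) ]?))                ∎
  where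
  open ≡-Reasoning
  row  = map (f zero ,_) (tabulate g)
  rest = cartesianProduct (tabulate (f ∘ suc)) (tabulate g)

∣D∣≡sum : ∀ {n} (D : Subset n) → + ∣ D ∣ ≡ sum (λ x → [ x ∈? D ]?)
∣D∣≡sum []            = refl
∣D∣≡sum (inside ∷ D)  = cong (λ z → + 1 + z) (∣D∣≡sum D)
∣D∣≡sum (outside ∷ D) = trans (∣D∣≡sum D) (sym (ℤₚ.+-identityˡ _))

module RegularPDS {v : ℕ} (G : FinAbGroup v) (D : Subset v) (regular : IsRegular G D)
                  {k lam mu : ℤ} (isPDS : IsPDS G D k lam mu) where
  open FinAbGroup G
  open Powers G
  open IntegralGroupRing G

  χ : Fin v → ℤ
  χ x = [ x ∈? D ]?

  χ-∈ : ∀ {x} → x ∈ D → χ x ≡ + 1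
  χ-∈ {x} x∈D with x ∈? D
  ... | yes _  = refl
  ... | no x∉D = contradiction x∈D x∉D

  χ-∉ : ∀ {x} → ¬ x ∈ D → χ x ≡ + 0
  χ-∉ {x} x∉D with x ∈? D
  ... | yes x∈D = contradiction x∈D x∉D
  ... | no _    = refl

  χ-inv : ∀ x → χ (inv x) ≡ χ x
  χ-inv x with x ∈? D
  ... | yes x∈D = χ-∈ (proj₁ regular x x∈D)
  ... | no x∉D  = χ-∉ (x∉D ∘ proj₁ (proj₂ regular) x)

  χ-e : χ e ≡ + 0
  χ-e = χ-∉ (proj₂ (proj₂ regular))

  sum-χ : sum χ ≡ k
  sum-χ = trans (sym (∣D∣≡sum D)) (proj₁ isPDS)

  -- The count runs over quotients and convolution over products; the symmetry of D allows b to be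
  -- replaced by its inverse. The condition a ≢ b is automatic, as x ≢ e.
  repCount≡χ⊛χ : ∀ {x} → x ≢ e → + repCount G D x ≡ (χ ⊛ χ) x
  repCount≡χ⊛χ {x} x≢e = begin
    + repCount G D x
      ≡⟨ length-filter-cartesianProduct _ {v} {v} id id ⟩
    sum (λ a → sum (λ b → [ ((a ∈? D) ×-dec (b ∈? D)) ×-dec (¬? (a ≟ b) ×-dec ((a ∙ inv b) ≟ x)) ]?))
      ≡⟨ sum-cong-≗ (λ a → sum-cong-≗ (term a)) ⟩
    sum (λ a → sum (λ b → χ a * (χ b * δ (a ∙ inv b) x)))
      ≡⟨ sum-cong-≗ (λ a → *-distribˡ-sum (χ a) (λ b → χ b * δ (a ∙ inv b) x)) ⟨
    sum (λ a → χ a * sum (λ b → χ b * δ (a ∙ inv b) x))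
      ≡⟨ sum-cong-≗ (λ a → cong (λ z → χ a * z) (trans (sum-cong-≗ (λ b → cong (λ z → z * δ (a ∙ inv b) x) (sym (χ-inv b)))) (sum-inverse (λ b → χ b * δ (a ∙ b) x)))) ⟩
    (χ ⊛ χ) x ∎
    where
    open ≡-Reasoning
    term : ∀ a b → [ ((a ∈? D) ×-dec (b ∈? D)) ×-dec (¬? (a ≟ b) ×-dec ((a ∙ inv b) ≟ x)) ]? ≡ χ a * (χ b * δ (a ∙ inv b) x)
    term a b with a ∈? D | b ∈? D
    ... | no _  | _    = refl
    ... | yes _ | no _ = refl
    ... | yes _ | yes _ with a ≟ b | (a ∙ inv b) ≟ x
    ...   | yes refl | yes ab⁻¹≡x = contradiction (trans (sym ab⁻¹≡x) (G.inverseʳ a)) x≢e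
    ...   | yes refl | no _       = refl
    ...   | no _     | yes _      = refl
    ...   | no _     | no _       = refl

  χ⊛χ-e : (χ ⊛ χ) e ≡ k
  χ⊛χ-e = begin
    (χ ⊛ χ) e                         ≡⟨ ⊛-expand χ χ e ⟩
    sum (λ a → χ a * χ (inv a ∙ e))   ≡⟨ sum-cong-≗ (λ a → trans (cong (λ z → χ a * z) (trans (cong χ (G.identityʳ (inv a))) (χ-inv a))) (idem a)) ⟩
    sum χ                             ≡⟨ sum-χ ⟩
    k                                 ∎
    where
    open ≡-Reasoning
    idem : ∀ a → χ a * χ a ≡ χ a
    idem a with a ∈? D
    ... | yes _ = refl
    ... | no _  = refl

  -- The group ring equation D² = (k - mu) e + (lam - mu) D + mu G. At e the left side is k by
  -- symmetry of D, and the middle term vanishes because e is not in D.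
  χ⊛χ : ∀ x → (χ ⊛ χ) x ≡ (k - mu) * δ e x + (lam - mu) * χ x + mu
  χ⊛χ x with e ≟ x
  ... | yes refl = trans χ⊛χ-e (trans (lem k mu (lam - mu)) (cong (λ z → (k - mu) * + 1 + (lam - mu) * z + mu) (sym χ-e)))
    where lem : ∀ k mu β → k ≡ (k - mu) * + 1 + β * + 0 + mu
          lem = solve-∀
  ... | no e≢x with x ∈? D
  ...   | yes x∈D = trans (sym (repCount≡χ⊛χ (e≢x ∘ sym))) (trans (proj₁ (proj₂ isPDS) x (e≢x ∘ sym) x∈D) (lem k lam mu))
    where lem : ∀ k lam mu → lam ≡ (k - mu) * + 0 + (lam - mu) * + 1 + mu
          lem = solve-∀
  ...   | no x∉D = trans (sym (repCount≡χ⊛χ (e≢x ∘ sym))) (trans (proj₂ (proj₂ isPDS) x (e≢x ∘ sym) x∉D) (lem k lam mu))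
    where lem : ∀ k lam mu → mu ≡ (k - mu) * + 0 + (lam - mu) * + 0 + mu
          lem = solve-∀

-- Parity and residue arguments for the values of A.

[]?-mod : ∀ {a b} {A : Set a} {B : Set b} {s} → s ≢ 1 → (d : Dec A) (d′ : Dec B) → s ℕ∣.∣ ℤ.∣ [ d ]? - [ d′ ]? ∣ → [ d ]? ≡ [ d′ ]?
[]?-mod s≢1 (yes _) (yes _) _   = refl
[]?-mod s≢1 (yes _) (no _)  s∣1 = contradiction (ℕ∣.∣1⇒≡1 s∣1) s≢1
[]?-mod s≢1 (no _)  (yes _) s∣1 = contradiction (ℕ∣.∣1⇒≡1 s∣1) s≢1
[]?-mod s≢1 (no _)  (no _)  _   = refl

-- Modulo 2, a ≡ p a ≡ p² ≡ 1. The witness comes from p = 1 + 2Q and p² = 1 + 4 (Q² + Q).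
odd-quotient : ∀ {p} → ¬ 2 ℕ∣.∣ p → ∀ a X → + p * a ≡ + 2 * X - + p * + p → ∃ λ t → a + + 1 ≡ + 2 * t
odd-quotient 2∤p a X pa≡ with odd⇒1+2q 2∤p
... | q , refl = X - + 2 * (Q * Q + Q) - Q * a , (begin
  a + + 1                                              ≡⟨ lem a Q ⟩
  (+ 1 + Q * + 2) * a - + 2 * Q * a + + 1              ≡⟨ cong (λ z → (+ 1 + z) * a - + 2 * Q * a + + 1) (ℤₚ.pos-* q 2) ⟨
  (+ 1 + + (q ℕ.* 2)) * a - + 2 * Q * a + + 1          ≡⟨ cong (λ z → z - + 2 * Q * a + + 1) pa≡ ⟩
  + 2 * X - (+ 1 + + (q ℕ.* 2)) * (+ 1 + + (q ℕ.* 2)) - + 2 * Q * a + + 1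
    ≡⟨ cong (λ z → + 2 * X - (+ 1 + z) * (+ 1 + z) - + 2 * Q * a + + 1) (ℤₚ.pos-* q 2) ⟩
  + 2 * X - (+ 1 + Q * + 2) * (+ 1 + Q * + 2) - + 2 * Q * a + + 1 ≡⟨ lem′ X Q a ⟩
  + 2 * (X - + 2 * (Q * Q + Q) - Q * a)                ∎)
  where
  open ≡-Reasoning
  Q = + q
  lem : ∀ a q → a + + 1 ≡ (+ 1 + q * + 2) * a - + 2 * q * a + + 1
  lem = solve-∀
  lem′ : ∀ x q a → + 2 * x - (+ 1 + q * + 2) * (+ 1 + q * + 2) - + 2 * q * a + + 1 ≡ + 2 * (x - + 2 * (q * q + q) - q * a)
  lem′ = solve-∀

-- X = p (p - 1) / 2 is an odd multiple of (p - 1) / 2, so for p > 3 it is neither 0 nor 1 modulo p - 1.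
half-residue : ∀ {p} → ¬ 2 ℕ∣.∣ p → 3 ℕ.< p → ∀ {A : Set} (d : Dec A) q X →
               + p * - + 1 ≡ + 2 * X - + p * + p → X ≢ q * + (p ℕ.∸ 1) + [ d ]?
half-residue {p@(suc r)} 2∤p 3<p d q X -p≡ refl = absurd d (begin
  + 2 * [ d ]?                                                 ≡⟨ lem (q * + r) [ d ]? (+ p) ⟩
  + 2 * (q * + r + [ d ]?) - + p * + p - + 2 * (q * + r) + + p * + p ≡⟨ cong (λ z → z - + 2 * (q * + r) + + p * + p) -p≡ ⟨
  + p * - + 1 - + 2 * (q * + r) + + p * + p                    ≡⟨ lem′ q (+ r) ⟩
  (+ p - + 2 * q) * + r                                        ∎)
  where
  open ≡-Reasoning
  lem : ∀ m d P → + 2 * d ≡ + 2 * (m + d) - P * P - + 2 * m + P * P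
  lem = solve-∀
  lem′ : ∀ q r → (+ 1 + r) * - + 1 - + 2 * (q * r) + (+ 1 + r) * (+ 1 + r) ≡ (+ 1 + r - + 2 * q) * r
  lem′ = solve-∀
  2<r : 2 ℕ.< r
  2<r = ℕ.s≤s⁻¹ 3<p
  -- In the first case p - 1 > 2 would divide 2. In the second, p = 2q would be even or p - 1 would
  -- be 0.
  absurd : (d : Dec _) → + 2 * [ d ]? ≢ (+ p - + 2 * q) * + r
  absurd (yes _) eq = ℕₚ.<⇒≱ 2<r (ℕ∣.∣⇒≤ (≡0⇒∣ {+ 2} (mod (+ p - + 2 * q) (trans eq (sym (ℤₚ.+-identityˡ _))))))
  absurd (no _)  eq with ℤₚ.i*j≡0⇒i≡0∨j≡0 (+ p - + 2 * q) (sym eq)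
  ... | inj₁ p-2q≡0 = 2∤p (≡0⇒∣ {+ p} (mod q (trans (lem″ (+ p) q) (cong (λ z → z + q * + 2) p-2q≡0))))
    where lem″ : ∀ p q → p ≡ p - + 2 * q + q * + 2
          lem″ = solve-∀
  ... | inj₂ refl = contradiction 2<r (λ ())

-- With a + 1 = 2t the right side is 4t² - 4, and t = 0 is possible only where B holds. In the
-- application B is the equation e ≡ x, the point about which nothing is claimed. The factor `+ 1`
-- stands for the value of `1N`.
-4≤odd²+2odd-3 : ∀ {B : Set} a → (∃ λ t → a + + 1 ≡ + 2 * t) → (d : Dec B) → (¬ B → a ≢ - + 1) →
                 - + 4 * [ d ]? ℤ.≤ a * a + (+ 2 * a + - + 3 * + 1)
-4≤odd²+2odd-3 a (t , a+1≡2t) d a≢-1 = subst (- + 4 * [ d ]? ℤ.≤_) (sym g≡) (bound d a≢-1)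
  where
  g≡ : a * a + (+ 2 * a + - + 3 * + 1) ≡ + 4 * (t * t) - + 4
  g≡ = trans (lem a) (trans (cong (λ z → z * z - + 4) a+1≡2t) (lem′ t))
    where
    lem : ∀ a → a * a + (+ 2 * a + - + 3 * + 1) ≡ (a + + 1) * (a + + 1) - + 4
    lem = solve-∀
    lem′ : ∀ t → + 2 * t * (+ 2 * t) - + 4 ≡ + 4 * (t * t) - + 4
    lem′ = solve-∀
  0≤t² : ∀ t → + 0 ℤ.≤ t * t
  0≤t² (+ n)    = subst (+ 0 ℤ.≤_) (ℤₚ.pos-* n n) (ℤ.+≤+ ℕ.z≤n)
  0≤t² -[1+ n ] = ℤ.+≤+ ℕ.z≤n
  1≤t² : ∀ t → t ≢ + 0 → + 1 ℤ.≤ t * t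
  1≤t² (+ zero)  t≢0 = contradiction refl t≢0
  1≤t² (+ suc n) _   = ℤ.+≤+ (ℕ.s≤s ℕ.z≤n)
  1≤t² -[1+ n ]  _   = ℤ.+≤+ (ℕ.s≤s ℕ.z≤n)
  4t²-4-mono : ∀ {m} → m ℤ.≤ t * t → + 4 * m - + 4 ℤ.≤ + 4 * (t * t) - + 4
  4t²-4-mono m≤t² = ℤₚ.+-monoˡ-≤ (- + 4) (ℤₚ.*-monoˡ-≤-nonNeg (+ 4) m≤t²)
  bound : (d : Dec _) → (¬ _ → a ≢ - + 1) → - + 4 * [ d ]? ℤ.≤ + 4 * (t * t) - + 4
  bound (yes _) _    = 4t²-4-mono (0≤t² t)
  bound (no ¬b) a≢-1 = 4t²-4-mono (1≤t² t (λ t≡0 → a≢-1 ¬b (trans (lem a) (cong (λ z → z - + 1) (trans a+1≡2t (cong (λ z → + 2 * z) t≡0))))))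
    where lem : ∀ a → a ≡ a + + 1 - + 1
          lem = solve-∀

-- Regular partial difference sets in groups of order 8p³.

module RegularPDS8p³ {v p : ℕ} (v≡8p³ : v ≡ 8 ℕ.* p ℕ.^ 3) (p-prime : Prime p) (2<p : 2 ℕ.< p)
            (G : FinAbGroup v) (D : Subset v) (regular : IsRegular G D)
            (b : ℤ) (b²+b≡4p-2 : b * b + b ≡ + 4 * + p - + 2)
            (isPDS : IsPDS G D (+ 4 * + p * + p - + 2 * + p + b) (+ 2 * + p - + 2 + + 2 * b) (+ 2 * + p - + 2)) where
  open FinAbGroup G
  open Powers G
  open IntegralGroupRing G
  open Sylow v≡8p³ p-prime 2<p G
  open RegularPDS G D regular isPDS
  open Teichmüller v≡8p³ p-prime 2<p G

  P = + p
  private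
    module R = CommutativeRing groupRing
    instance
      p≢0 : ℕ.NonZero p
      p≢0 = prime⇒nonZero p-prime
      P²≢0 : ℤ.NonZero (P * P)
      P²≢0 = ℤₚ.i*j≢0 P P

  F : Fin v → ℤ
  F x = + 2 * P * χ x + (- (+ 2 * P * b) * δ e x + - + 1 * 𝟏 x)

  +v≡8P³ : + v ≡ + 8 * (P * (P * (P * + 1)))
  +v≡8P³ = trans (cong +_ v≡8p³) (trans (ℤₚ.pos-* 8 (p ℕ.^ 3)) (cong (λ z → + 8 * z) (pos-^ p 3)))

  sum-F : sum F ≡ - (+ 4 * P * P)
  sum-F = begin
    sum F ≡⟨ ∑-distrib-+ (λ x → + 2 * P * χ x) (λ x → - (+ 2 * P * b) * δ e x + - + 1 * 𝟏 x) ⟩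
    sum (λ x → + 2 * P * χ x) + sum (λ x → - (+ 2 * P * b) * δ e x + - + 1 * 𝟏 x)
      ≡⟨ cong₂ _+_ (sym (*-distribˡ-sum (+ 2 * P) χ)) (∑-distrib-+ (λ x → - (+ 2 * P * b) * δ e x) (λ x → - + 1 * 𝟏 x)) ⟩
    + 2 * P * sum χ + (sum (λ x → - (+ 2 * P * b) * δ e x) + sum (λ x → - + 1 * 𝟏 x))
      ≡⟨ cong₂ (λ z w → + 2 * P * sum χ + (z + w)) (sym (*-distribˡ-sum (- (+ 2 * P * b)) (δ e))) (sym (*-distribˡ-sum (- + 1) 𝟏)) ⟩
    + 2 * P * sum χ + (- (+ 2 * P * b) * sum (δ e) + - + 1 * sum 𝟏)
      ≡⟨ cong₂ (λ z w → + 2 * P * z + w) sum-χ (cong₂ (λ z w → - (+ 2 * P * b) * z + - + 1 * w) (sum-δ e) (trans (sum-1 v) +v≡8P³)) ⟩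
    + 2 * P * (+ 4 * P * P - + 2 * P + b) + (- (+ 2 * P * b) * + 1 + - + 1 * (+ 8 * (P * (P * (P * + 1)))))
      ≡⟨ lem P b ⟩
    - (+ 4 * P * P) ∎
    where
    open ≡-Reasoning
    lem : ∀ P b → + 2 * P * (+ 4 * P * P - + 2 * P + b) + (- (+ 2 * P * b) * + 1 + - + 1 * (+ 8 * (P * (P * (P * + 1))))) ≡ - (+ 4 * P * P)
    lem = solve-∀

  F⊛ : ∀ g x → (F ⊛ g) x ≡ + 2 * P * (χ ⊛ g) x + (- (+ 2 * P * b) * g x + - + 1 * sum g)
  F⊛ g x = begin
    (F ⊛ g) x ≡⟨ R.distribʳ g (λ y → + 2 * P * χ y) (λ y → - (+ 2 * P * b) * δ e y + - + 1 * 𝟏 y) x ⟩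
    ((λ y → + 2 * P * χ y) ⊛ g) x + ((λ y → - (+ 2 * P * b) * δ e y + - + 1 * 𝟏 y) ⊛ g) x
      ≡⟨ cong₂ _+_ (⊛-scaleˡ (+ 2 * P) χ g x) (R.distribʳ g (λ y → - (+ 2 * P * b) * δ e y) (λ y → - + 1 * 𝟏 y) x) ⟩
    + 2 * P * (χ ⊛ g) x + (((λ y → - (+ 2 * P * b) * δ e y) ⊛ g) x + ((λ y → - + 1 * 𝟏 y) ⊛ g) x)
      ≡⟨ cong (λ z → + 2 * P * (χ ⊛ g) x + z) (cong₂ _+_
           (trans (⊛-scaleˡ (- (+ 2 * P * b)) (δ e) g x) (cong (λ z → - (+ 2 * P * b) * z) (R.*-identityˡ g x)))
           (trans (⊛-scaleˡ (- + 1) 𝟏 g x) (cong (λ z → - + 1 * z) 𝟏⊛g))) ⟩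
    + 2 * P * (χ ⊛ g) x + (- (+ 2 * P * b) * g x + - + 1 * sum g) ∎
    where
    open ≡-Reasoning
    𝟏⊛g : (𝟏 ⊛ g) x ≡ sum g
    𝟏⊛g = trans (R.*-comm 𝟏 g x) (trans (⊛-invariant g 𝟏 (λ _ → inj₂ (λ _ → refl)) x) (ℤₚ.*-identityʳ (sum g)))

  -- The terms in `χ x` and the constants cancel identically; only the coefficient of `δ e x`
  -- requires b² + b = 4p - 2.
  F⊛F : ∀ x → (F ⊛ F) x ≡ (+ 4 * P * P) * (+ 4 * P * P) * δ e x
  F⊛F x = begin
    (F ⊛ F) x ≡⟨ F⊛ F x ⟩
    + 2 * P * (χ ⊛ F) x + (- (+ 2 * P * b) * F x + - + 1 * sum F)
      ≡⟨ cong₂ (λ z w → + 2 * P * z + (- (+ 2 * P * b) * F x + - + 1 * w)) (trans (R.*-comm χ F x) (F⊛ χ x)) sum-F ⟩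
    + 2 * P * (+ 2 * P * (χ ⊛ χ) x + (- (+ 2 * P * b) * χ x + - + 1 * sum χ)) + (- (+ 2 * P * b) * F x + - + 1 * - (+ 4 * P * P))
      ≡⟨ cong₂ (λ z w → + 2 * P * (+ 2 * P * z + (- (+ 2 * P * b) * χ x + - + 1 * w)) + (- (+ 2 * P * b) * F x + - + 1 * - (+ 4 * P * P))) (χ⊛χ x) sum-χ ⟩
    _ ≡⟨ lem P b (χ x) (δ e x) ⟩
    + 4 * P * P * (+ 4 * P * P - + 4 * P + + 2 + (b * b + b)) * δ e x
      ≡⟨ cong (λ z → + 4 * P * P * (+ 4 * P * P - + 4 * P + + 2 + z) * δ e x) b²+b≡4p-2 ⟩
    + 4 * P * P * (+ 4 * P * P - + 4 * P + + 2 + (+ 4 * P - + 2)) * δ e x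
      ≡⟨ lem′ P (δ e x) ⟩
    (+ 4 * P * P) * (+ 4 * P * P) * δ e x ∎
    where
    open ≡-Reasoning
    lem : ∀ P b d t →
      + 2 * P * (+ 2 * P * ((+ 4 * P * P - + 2 * P + b - (+ 2 * P - + 2)) * t + (+ 2 * P - + 2 + + 2 * b - (+ 2 * P - + 2)) * d + (+ 2 * P - + 2))
        + (- (+ 2 * P * b) * d + - + 1 * (+ 4 * P * P - + 2 * P + b)))
      + (- (+ 2 * P * b) * (+ 2 * P * d + (- (+ 2 * P * b) * t + - + 1 * + 1)) + - + 1 * - (+ 4 * P * P))
      ≡ + 4 * P * P * (+ 4 * P * P - + 4 * P + + 2 + (b * b + b)) * t
    lem = solve-∀
    lem′ : ∀ P t → + 4 * P * P * (+ 4 * P * P - + 4 * P + + 2 + (+ 4 * P - + 2)) * t ≡ (+ 4 * P * P) * (+ 4 * P * P) * t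
    lem′ = solve-∀

  c = + 4 * P * P

  module _ {s : ℕ} (s-prime : Prime s) (s⊥v : Coprime s (8 ℕ.* p ℕ.^ 3)) where
    private
      module S = CommutativeRing (ℤ/ s)
      module M = GroupRing (ℤ/ s) G
      module MR = CommutativeRing M.groupRing
      open Algebra.Properties.CommutativeSemiring.Exp S.commutativeSemiring using (_^_)
      open import Relation.Binary.Reasoning.Setoid S.setoid

    F^[2+n] : ∀ n x → (F M.⊛^ (2 ℕ.+ n)) x S.≈ c * c * (F M.⊛^ n) x
    F^[2+n] n x = begin
      (F M.⊛ (F M.⊛ (F M.⊛^ n))) x                  ≈⟨ MR.*-assoc F F (F M.⊛^ n) x ⟨
      ((F M.⊛ F) M.⊛ (F M.⊛^ n)) x                  ≈⟨ MR.*-congʳ {F M.⊛^ n} {F M.⊛ F} {λ y → c * c * M.δ e y} (λ y → S.reflexive (F⊛F y)) x ⟩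
      ((λ y → c * c * M.δ e y) M.⊛ (F M.⊛^ n)) x    ≈⟨ M.⊛-scaleˡ (c * c) (M.δ e) (F M.⊛^ n) x ⟩
      c * c * (M.δ e M.⊛ (F M.⊛^ n)) x              ≈⟨ S.*-congˡ {c * c} (MR.*-identityˡ (F M.⊛^ n) x) ⟩
      c * c * (F M.⊛^ n) x                          ∎

    F^[1+2m] : ∀ m x → (F M.⊛^ (1 ℕ.+ m ℕ.* 2)) x S.≈ c ^ (m ℕ.* 2) * F x
    F^[1+2m] zero    x = S.trans (MR.*-identityʳ F x) (S.reflexive (sym (ℤₚ.*-identityˡ (F x))))
    F^[1+2m] (suc m) x = begin
      (F M.⊛^ (2 ℕ.+ (1 ℕ.+ m ℕ.* 2))) x  ≈⟨ F^[2+n] (1 ℕ.+ m ℕ.* 2) x ⟩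
      c * c * (F M.⊛^ (1 ℕ.+ m ℕ.* 2)) x  ≈⟨ S.*-congˡ {c * c} (F^[1+2m] m x) ⟩
      c * c * (c ^ (m ℕ.* 2) * F x)       ≡⟨ lem c (c ^ (m ℕ.* 2)) (F x) ⟩
      c * (c * c ^ (m ℕ.* 2)) * F x       ∎
      where lem : ∀ c d f → c * c * (d * f) ≡ c * (c * d) * f
            lem = solve-∀

    -- For odd s, F ^ s = c ^ (s - 1) F. The extra factor c completes this to c ^ s, so Fermat
    -- applies without inverting c modulo s.
    cF^s≈cF : ∀ x → c * (F M.⊛^ s) x S.≈ c * F x
    cF^s≈cF x with odd⇒1+2q 2∤s
      where
      2∤s : ¬ 2 ℕ∣.∣ s
      2∤s 2∣s with s⊥v (2∣s , ℕ∣.∣m⇒∣m*n (p ℕ.^ 3) (ℕ∣.divides 4 refl))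
      ... | ()
    ... | m , s≡1+2m = begin
      c * (F M.⊛^ s) x                  ≡⟨ cong (λ n → c * (F M.⊛^ n) x) s≡1+2m ⟩
      c * (F M.⊛^ (1 ℕ.+ m ℕ.* 2)) x    ≈⟨ S.*-congˡ {c} (F^[1+2m] m x) ⟩
      c * (c ^ (m ℕ.* 2) * F x)         ≡⟨ ℤₚ.*-assoc c (c ^ (m ℕ.* 2)) (F x) ⟨
      c ^ (1 ℕ.+ m ℕ.* 2) * F x         ≡⟨ cong (λ n → c ^ n * F x) s≡1+2m ⟨
      c ^ s * F x                       ≈⟨ S.*-congʳ {F x} (fermat s-prime c) ⟩
      c * F x                           ∎

    cFx≈cF[s·x] : ∀ x → c * F x S.≈ c * F (s · x)
    cFx≈cF[s·x] x = begin
      c * F x                        ≈⟨ S.*-congˡ {c} (M.push-injective {φ = s ·_} F x inj) ⟨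
      c * M.push (s ·_) F (s · x)    ≈⟨ S.*-congˡ {c} (M.frobenius s-prime ℤ/-char (fermat s-prime) F (s · x)) ⟨
      c * (F M.⊛^ s) (s · x)         ≈⟨ cF^s≈cF (s · x) ⟩
      c * F (s · x)                  ∎
      where
      inj : ∀ a → s · a ≡ s · x → a ≡ x ⊎ F a S.≈ + 0
      inj a eq = inj₁ (·-injective s⊥v (8p³·x≡e a) (8p³·x≡e x) eq)

    -- In c F x - c F (s · x) everything cancels but 8p³ (χ x - χ (s · x)). As s is prime to 8p³ it
    -- divides the difference of two values in {0, 1}.
    multiplier-prime : ∀ x → χ x ≡ χ (s · x)
    multiplier-prime x = []?-mod s≢1 (x ∈? D) ((s · x) ∈? D)
      (coprime-divisor s⊥v (ℕ∣.divides ℤ.∣ q ∣ (trans (sym abs-lhs) (trans (cong ℤ.∣_∣ step) (ℤₚ.abs-* q (+ s))))))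
      where
      open _≡_[mod_] (cFx≈cF[s·x] x) renaming (quot to q; a≡b+qs to eq)
      s≢1 : s ≢ 1
      s≢1 refl = ¬prime[1] s-prime
      δ-s· : δ e (s · x) ≡ δ e x
      δ-s· = δ-⇔ {a = e} {s · x} {e} {x}
        (λ eq → sym (·-coprime s⊥v (sym eq) (8p³·x≡e x))) (λ { refl → sym (·-e s) })
      u = χ x
      w = χ (s · x)
      abs-lhs : ℤ.∣ + (8 ℕ.* p ℕ.^ 3) * (u - w) ∣ ≡ 8 ℕ.* p ℕ.^ 3 ℕ.* ℤ.∣ u - w ∣
      abs-lhs = ℤₚ.abs-* (+ (8 ℕ.* p ℕ.^ 3)) (u - w)
      lem : ∀ P b u w t → + 8 * (P * (P * (P * + 1))) * (u - w) ≡
              + 4 * P * P * (+ 2 * P * u + (- (+ 2 * P * b) * t + - + 1 * + 1)) - + 4 * P * P * (+ 2 * P * w + (- (+ 2 * P * b) * t + - + 1 * + 1))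
      lem = solve-∀
      lem′ : ∀ f q → f + q - f ≡ q
      lem′ = solve-∀
      step : + (8 ℕ.* p ℕ.^ 3) * (u - w) ≡ q * + s
      step = trans (cong (λ z → z * (u - w)) (trans (cong +_ (sym v≡8p³)) +v≡8P³)) (trans (lem P b u w (δ e x))
        (trans (cong (λ t → c * F x - c * (+ 2 * P * w + (- (+ 2 * P * b) * t + - + 1 * + 1))) (sym δ-s·))
        (trans (cong (λ z → z - c * F (s · x)) eq) (lem′ (c * F (s · x)) (q * + s)))))

  multiplier-product : ∀ {ps} → All Prime ps → Coprime (product ps) (8 ℕ.* p ℕ.^ 3) → ∀ x → χ x ≡ χ (product ps · x)
  multiplier-product [] _ x = cong χ (sym (G.identityʳ x))
  multiplier-product {s ∷ ps} (s-prime ∷ ps-prime) cop x = begin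
    χ x                      ≡⟨ multiplier-product ps-prime (λ { (d∣ps , d∣v) → cop (ℕ∣.∣n⇒∣m*n s d∣ps , d∣v) }) x ⟩
    χ (product ps · x)       ≡⟨ multiplier-prime s-prime (λ { (d∣s , d∣v) → cop (ℕ∣.∣m⇒∣m*n (product ps) d∣s , d∣v) }) (product ps · x) ⟩
    χ (s · (product ps · x)) ≡⟨ cong χ (·-assocˡ x s (product ps)) ⟩
    χ (product (s ∷ ps) · x) ∎
    where open ≡-Reasoning

  multiplier : ∀ n → .{{ℕ.NonZero n}} → Coprime n (8 ℕ.* p ℕ.^ 3) → ∀ x → χ x ≡ χ (n · x)
  multiplier n cop x = subst (λ m → χ x ≡ χ (m · x)) (sym isFactorisation)
    (multiplier-product factorsPrime (subst (λ m → Coprime m (8 ℕ.* p ℕ.^ 3)) isFactorisation cop) x)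
    where open PrimeFactorisation (factorise n)

  -- The multiplier of `act i` may be even, and it may move n. By the Chinese remainder theorem it
  -- is replaced by τ a, which is prime to 8p³, fixes n and acts on x as before. In a, the summand
  -- p² is 1 modulo 8 and 0 modulo p, and w inverts 8 modulo p.
  χ-act : ∀ {n x} → φ n ≡ n → (p ℕ.^ 3) · x ≡ e → ∀ i → χ (n ∙ act i x) ≡ χ (n ∙ x)
  χ-act {n} {x} φn≡n p³·x≡e i = sym (trans (multiplier (τ a) {{τa≢0}} τa⊥v (n ∙ x)) (cong χ τa·nx))
    where
    module S = CommutativeRing (ℤ/ p)
    module E = CommutativeRing (ℤ/ 8)
    inverse = mod-inverse p⊥8
    w = proj₁ inverse
    -- a ≡ 1 modulo 8 and a ≡ unit i modulo p.
    a = p ℕ.* p ℕ.+ w ℕ.* 8 ℕ.* unit i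
    a≡ : + a ≡ + p * + p + + (w ℕ.* 8) * + unit i
    a≡ = cong₂ _+_ (ℤₚ.pos-* p p) (ℤₚ.pos-* (w ℕ.* 8) (unit i))
    a≡1 : + a ≡ + 1 [mod 8 ]
    a≡1 = E.trans (E.reflexive a≡) (E.trans (E.+-cong (odd²≡1[mod8] 2∤p) (E.*-congʳ {+ unit i} (∣⇒≡0 {+ (w ℕ.* 8)} (ℕ∣.n∣m*n w))))
            (E.reflexive (cong (λ z → + 1 + z) (ℤₚ.*-zeroˡ (+ unit i)))))
    a≡i : + a ≡ + unit i [mod p ]
    a≡i = S.trans (S.reflexive a≡) (S.trans (S.+-cong (S.trans (S.reflexive (sym (ℤₚ.pos-* p p))) (∣⇒≡0 {+ (p ℕ.* p)} (ℕ∣.m∣m*n p))) (S.*-congʳ {+ unit i} (proj₂ inverse)))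
            (S.reflexive (trans (ℤₚ.+-identityˡ (+ 1 * + unit i)) (ℤₚ.*-identityˡ (+ unit i)))))
    p∤a : ¬ p ℕ∣.∣ a
    p∤a p∣a = p∤unit i (≡0⇒∣ {+ unit i} (S.trans (S.sym a≡i) (∣⇒≡0 {+ a} p∣a)))
    8·n≡e : 8 · n ≡ e
    8·n≡e = subst (λ z → 8 · z ≡ e) φn≡n (8·φx≡e n)
    pos-^-≡1 : ∀ k → + (a ℕ.^ k) ≡ + 1 [mod 8 ]
    pos-^-≡1 zero    = E.refl
    pos-^-≡1 (suc k) = E.trans (E.reflexive (ℤₚ.pos-* a (a ℕ.^ k))) (E.*-cong a≡1 (pos-^-≡1 k))
    τa⊥v : Coprime (τ a) (8 ℕ.* p ℕ.^ 3)
    τa⊥v = coprime-* (≡1⇒coprime (pos-^-≡1 (p ℕ.^ 2))) (τ-coprime p∤a)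
    τa≢0 : ℕ.NonZero (τ a)
    τa≢0 = ℕₚ.m^n≢0 a (p ℕ.^ 2) {{ℕ.≢-nonZero (λ a≡0 → p∤a (subst (p ℕ∣.∣_) (sym a≡0) (p ℕ∣.∣0)))}}
    τa·nx : τ a · (n ∙ x) ≡ n ∙ act i x
    τa·nx = trans (·-distrib-∙ n x (τ a)) (cong₂ _∙_ (trans (·-mod 8·n≡e (pos-^-≡1 (p ℕ.^ 2))) (G.identityʳ n)) (τ-cong p³·x≡e a≡i))

  P\e? : ∀ x → Dec (P\e x)
  P\e? x = (((p ℕ.^ 3) · x) ≟ e) ×-dec ¬? (x ≟ e)

  private
    module Count {n : Fin v} (φn≡n : φ n ≡ n) where
      w : Fin v → ℤ
      w x = [ P\e? x ]? * χ (n ∙ x)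

      w-P\e : ∀ {x} → P\e x → w x ≡ χ (n ∙ x)
      w-P\e {x} Tx = trans (cong (λ t → (if t then + 1 else + 0) * χ (n ∙ x)) (dec-true (P\e? x) Tx)) (ℤₚ.*-identityˡ (χ (n ∙ x)))

      w-supported : ∀ x → w x ≡ + 0 ⊎ P\e x
      w-supported x with P\e? x
      ... | yes Tx = inj₂ Tx
      ... | no ¬Tx = inj₁ (trans (cong (λ t → (if t then + 1 else + 0) * χ (n ∙ x)) (dec-false (P\e? x) ¬Tx)) (ℤₚ.*-zeroˡ (χ (n ∙ x))))

      open Orbits act P\e w act-refl act-sym act-trans act-free act-closed
        (λ Tx i → trans (w-P\e (act-closed Tx i)) (trans (χ-act φn≡n (proj₁ Tx) i) (sym (w-P\e Tx)))) w-supported using (d∣sum) public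

      -- Translation by n moves the coset nP to P. There the identity is the one point outside the
      -- free orbits, and it contributes χ n.
      push-χ : push φ χ n ≡ sum w + χ n
      push-χ = begin
        sum (λ x → χ x * δ (φ x) n)                   ≡⟨ sum-translate n (λ x → χ x * δ (φ x) n) ⟨
        sum (λ x → χ (n ∙ x) * δ (φ (n ∙ x)) n)       ≡⟨ sum-cong-≗ term ⟩
        sum (λ x → w x + δ e x * χ (n ∙ x))           ≡⟨ ∑-distrib-+ w (λ x → δ e x * χ (n ∙ x)) ⟩
        sum w + sum (λ x → δ e x * χ (n ∙ x))         ≡⟨ cong (λ z → sum w + z) (trans (⟨δ,⟩ e (λ x → χ (n ∙ x))) (cong χ (G.identityʳ n))) ⟩
        sum w + χ n                                   ∎
        where
        open ≡-Reasoning
        φ[nx] : ∀ x → φ (n ∙ x) ≡ n ∙ φ x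
        φ[nx] x = trans (φ-homo n x) (cong (_∙ φ x) φn≡n)
        δ-split : ∀ x → δ (φ (n ∙ x)) n ≡ [ P\e? x ]? + δ e x
        δ-split x with e ≟ x
        ... | yes refl = trans (trans (cong (λ z → δ z n) (trans (cong φ (G.identityʳ n)) φn≡n)) (δ-refl n))
                           (cong (λ t → (if t then + 1 else + 0) + + 1) (sym (dec-false (P\e? e) (λ Te → proj₂ Te refl))))
        ... | no e≢x = trans (cong (λ t → if t then + 1 else + 0) (does-⇔ (mk⇔
            (λ eq → φx≡e⇒p³·x≡e (identityʳ-unique n (φ x) (trans (sym (φ[nx] x)) eq)) , e≢x ∘ sym)
            (λ (p³·x≡e , _) → trans (φ[nx] x) (trans (cong (n ∙_) (trans (sym (·-assocˡ x p (p ℕ.^ 3))) (trans (cong (p ·_) p³·x≡e) (·-e p)))) (G.identityʳ n)))) (φ (n ∙ x) ≟ n) (P\e? x)))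
            (sym (ℤₚ.+-identityʳ [ P\e? x ]?))
        term : ∀ x → χ (n ∙ x) * δ (φ (n ∙ x)) n ≡ w x + δ e x * χ (n ∙ x)
        term x = trans (ℤₚ.*-comm (χ (n ∙ x)) (δ (φ (n ∙ x)) n))
          (trans (cong (λ z → z * χ (n ∙ x)) (δ-split x)) (ℤₚ.*-distribʳ-+ (χ (n ∙ x)) [ P\e? x ]? (δ e x)))

  push-χ≡χ[mod-p-1] : ∀ {n} → φ n ≡ n → ∃ λ q → push φ χ n ≡ q * + (p ℕ.∸ 1) + χ n
  push-χ≡χ[mod-p-1] {n} φn≡n = let (q , eq) = d∣sum in q , trans push-χ (cong (λ z → z + χ n) eq)
    where open Count φn≡n

  -- Serves both divisions by p, from `W` to `B` and from `B` to A.
  square-cancel : ∀ {f g : Fin v → ℤ} m → (∀ x → g x ≡ P * f x) → (∀ x → (g ⊛ g) x ≡ P * P * (m * δ e x)) → ∀ x → (f ⊛ f) x ≡ m * δ e x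
  square-cancel {f} {g} m g≡Pf g² x = ℤₚ.*-cancelˡ-≡ (P * P) _ _ (begin
    P * P * (f ⊛ f) x                          ≡⟨ ℤₚ.*-assoc P P _ ⟩
    P * (P * (f ⊛ f) x)                        ≡⟨ cong (λ z → P * z) (⊛-scaleˡ P f f x) ⟨
    P * ((λ y → P * f y) ⊛ f) x                ≡⟨ cong (λ z → P * z) (R.*-comm (λ y → P * f y) f x) ⟩
    P * (f ⊛ (λ y → P * f y)) x                ≡⟨ ⊛-scaleˡ P f (λ y → P * f y) x ⟨
    ((λ y → P * f y) ⊛ (λ y → P * f y)) x      ≡⟨ R.*-cong {g} {λ y → P * f y} {g} {λ y → P * f y} g≡Pf g≡Pf x ⟨
    (g ⊛ g) x                                  ≡⟨ g² x ⟩
    P * P * (m * δ e x)                        ∎)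
    where open ≡-Reasoning

  -- The first factor p of `W` is visible in the formula, since G is pushed forward to p³ times the
  -- indicator of N. The second is not, and needs the reducedness argument.
  W B : Fin v → ℤ
  W = push φ F
  B x = + 2 * push φ χ x - + 2 * b * δ e x - P * P * 1N x

  push-δ : ∀ x → push φ (δ e) x ≡ δ e x
  push-δ x = trans (⟨δ,⟩ e (λ a → δ (φ a) x)) (cong (λ z → δ z x) φ-e)

  W≡PB : ∀ x → W x ≡ P * B x
  W≡PB x = begin
    W x ≡⟨ ⟨⟩-distribˡ-+ (λ y → + 2 * P * χ y) (λ y → - (+ 2 * P * b) * δ e y + - + 1 * 𝟏 y) k ⟩
    ⟨ (λ y → + 2 * P * χ y) , k ⟩ + ⟨ (λ y → - (+ 2 * P * b) * δ e y + - + 1 * 𝟏 y) , k ⟩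
      ≡⟨ cong₂ _+_ (⟨⟩-scaleˡ (+ 2 * P) χ k) (⟨⟩-distribˡ-+ (λ y → - (+ 2 * P * b) * δ e y) (λ y → - + 1 * 𝟏 y) k) ⟩
    + 2 * P * push φ χ x + (⟨ (λ y → - (+ 2 * P * b) * δ e y) , k ⟩ + ⟨ (λ y → - + 1 * 𝟏 y) , k ⟩)
      ≡⟨ cong (λ z → + 2 * P * push φ χ x + z) (cong₂ _+_
           (trans (⟨⟩-scaleˡ (- (+ 2 * P * b)) (δ e) k) (cong (λ z → - (+ 2 * P * b) * z) (push-δ x)))
           (trans (⟨⟩-scaleˡ (- + 1) 𝟏 k) (cong (λ z → - + 1 * z) (trans (push-𝟏 x) (cong (λ z → z * 1N x) (trans ∣P∣≡p³ (pos-^ p 3))))))) ⟩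
    + 2 * P * push φ χ x + (- (+ 2 * P * b) * δ e x + - + 1 * (P * (P * (P * + 1)) * 1N x))
      ≡⟨ lem P b (push φ χ x) (δ e x) (1N x) ⟩
    P * B x ∎
    where
    open ≡-Reasoning
    k = λ a → δ (φ a) x
    lem : ∀ P b u t s → + 2 * P * u + (- (+ 2 * P * b) * t + - + 1 * (P * (P * (P * + 1)) * s)) ≡ P * (+ 2 * u - + 2 * b * t - P * P * s)
    lem = solve-∀

  W⊛W : ∀ x → (W ⊛ W) x ≡ P * P * (+ 16 * P * P * δ e x)
  W⊛W x = begin
    (W ⊛ W) x                        ≡⟨ push-⊛ φ-homo F F x ⟨
    push φ (F ⊛ F) x                 ≡⟨ sum-cong-≗ (λ a → cong (λ z → z * δ (φ a) x) (F⊛F a)) ⟩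
    push φ (λ y → c * c * δ e y) x   ≡⟨ ⟨⟩-scaleˡ (c * c) (δ e) (λ a → δ (φ a) x) ⟩
    c * c * push φ (δ e) x           ≡⟨ cong (λ z → c * c * z) (push-δ x) ⟩
    c * c * δ e x                    ≡⟨ lem P (δ e x) ⟩
    P * P * (+ 16 * P * P * δ e x)   ∎
    where
    open ≡-Reasoning
    lem : ∀ P t → (+ 4 * P * P) * (+ 4 * P * P) * t ≡ P * P * (+ 16 * P * P * t)
    lem = solve-∀

  B⊛B : ∀ x → (B ⊛ B) x ≡ + 16 * P * P * δ e x
  B⊛B = square-cancel (+ 16 * P * P) W≡PB W⊛W

  B-supp : ∀ x → 8 · x ≢ e → B x ≡ + 0
  B-supp x 8·x≢e = trans (cong₂ (λ u s → + 2 * u - + 2 * b * δ e x - P * P * s) push-χ≡0 (1N-supp x 8·x≢e))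
    (trans (cong (λ t → + 2 * + 0 - + 2 * b * t - P * P * + 0) (δ-≢ {a = e} (λ { refl → 8·x≢e (·-e 8) }))) (lem P b))
    where
    push-χ≡0 : push φ χ x ≡ + 0
    push-χ≡0 = sum-0 (λ a → trans (cong (λ z → χ a * z) (δ-≢ {a = φ a} (λ { refl → 8·x≢e (8·φx≡e a) }))) (ℤₚ.*-zeroʳ (χ a)))
    lem : ∀ P b → + 2 * + 0 - + 2 * b * + 0 - P * P * + 0 ≡ + 0
    lem = solve-∀

  B≡0[mod-p] : ∀ x → B x ≡ + 0 [mod p ]
  B≡0[mod-p] = ⊛-reduced p-prime p⊥8 B B-supp (λ x → mod (+ 16 * P * δ e x) (trans (B⊛B x) (lem P (δ e x))))
    where lem : ∀ P t → + 16 * P * P * t ≡ + 0 + + 16 * P * t * P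
          lem = solve-∀

  module Quotient (A : Fin v → ℤ) (B≡PA : ∀ x → B x ≡ P * A x) where

    W≡P²A : ∀ x → W x ≡ P * P * A x
    W≡P²A x = trans (W≡PB x) (trans (cong (λ z → P * z) (B≡PA x)) (sym (ℤₚ.*-assoc P P (A x))))

    A⊛A : ∀ x → (A ⊛ A) x ≡ + 16 * δ e x
    A⊛A = square-cancel (+ 16) B≡PA (λ x → trans (B⊛B x) (lem P (δ e x)))
      where lem : ∀ P t → + 16 * P * P * t ≡ P * P * (+ 16 * t)
            lem = solve-∀

    -- The symmetry of D passes to A; it turns the coefficient of A ⊛ A at e into a sum of squares.
    A-inv : ∀ x → A (inv x) ≡ A x
    A-inv x = ℤₚ.*-cancelˡ-≡ (P * P) _ _ (trans (sym (W≡P²A (inv x))) (trans W-inv (W≡P²A x)))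
      where
      F-inv : ∀ a → F (inv a) ≡ F a
      F-inv a = cong₂ (λ u t → + 2 * P * u + (- (+ 2 * P * b) * t + - + 1 * + 1)) (χ-inv a)
        (δ-⇔ {a = e} {inv a} {e} {a} (λ eq → trans (sym e⁻¹) (trans (cong inv eq) (⁻¹-involutive a))) (λ { refl → sym e⁻¹ }))
        where
        e⁻¹ : inv e ≡ e
        e⁻¹ = trans (sym (G.identityˡ (inv e))) (G.inverseʳ e)
      W-inv : W (inv x) ≡ W x
      W-inv = begin
        sum (λ a → F a * δ (φ a) (inv x))               ≡⟨ sum-inverse (λ a → F a * δ (φ a) (inv x)) ⟨
        sum (λ a → F (inv a) * δ (φ (inv a)) (inv x))   ≡⟨ sum-cong-≗ (λ a → cong₂ _*_ (F-inv a) (δ-⇔ {a = φ (inv a)} {inv x} {φ a} {x} (to a) (from a))) ⟩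
        sum (λ a → F a * δ (φ a) x)                     ∎
        where
        open ≡-Reasoning
        to : ∀ a → φ (inv a) ≡ inv x → φ a ≡ x
        to a eq = trans (sym (⁻¹-involutive (φ a))) (trans (cong inv (trans (sym (·-inverse (p ℕ.^ 4) a)) eq)) (⁻¹-involutive x))
        from : ∀ a → φ a ≡ x → φ (inv a) ≡ inv x
        from a eq = trans (·-inverse (p ℕ.^ 4) a) (cong inv eq)

    sum-A² : sum (λ x → A x * A x) ≡ + 16
    sum-A² = begin
      sum (λ x → A x * A x)             ≡⟨ sum-cong-≗ (λ x → cong (λ z → A x * z) (trans (cong A (G.identityʳ (inv x))) (A-inv x))) ⟨
      sum (λ x → A x * A (inv x ∙ e))   ≡⟨ ⊛-expand A A e ⟨
      (A ⊛ A) e                         ≡⟨ A⊛A e ⟩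
      + 16 * δ e e                      ≡⟨ cong (λ z → + 16 * z) (δ-refl e) ⟩
      + 16                              ∎
      where open ≡-Reasoning

    sum-A : sum A ≡ - + 4
    sum-A = ℤₚ.*-cancelˡ-≡ (P * P) _ _ (begin
      P * P * sum A             ≡⟨ *-distribˡ-sum (P * P) A ⟩
      sum (λ x → P * P * A x)   ≡⟨ sum-cong-≗ W≡P²A ⟨
      sum W                     ≡⟨ sum-cong-≗ (λ x → ℤₚ.*-identityʳ (W x)) ⟨
      ⟨ W , 𝟏 ⟩                 ≡⟨ ⟨push,⟩ φ F 𝟏 ⟩
      ⟨ F , 𝟏 ⟩                 ≡⟨ sum-cong-≗ (λ x → ℤₚ.*-identityʳ (F x)) ⟩
      sum F                     ≡⟨ sum-F ⟩
      - (+ 4 * P * P)           ≡⟨ lem P ⟩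
      P * P * - + 4             ∎)
      where
      open ≡-Reasoning
      lem : ∀ P → - (+ 4 * P * P) ≡ P * P * - + 4
      lem = solve-∀

    module OnN {x : Fin v} (φx≡x : φ x ≡ x) where
      PA≡ : P * A x ≡ + 2 * (push φ χ x - b * δ e x) - P * P
      PA≡ = trans (sym (B≡PA x)) (trans (cong (λ s → + 2 * push φ χ x - + 2 * b * δ e x - P * P * s) (trans (cong (λ z → δ z x) φx≡x) (δ-refl x))) (lem P b (push φ χ x) (δ e x)))
        where lem : ∀ P b u t → + 2 * u - + 2 * b * t - P * P * + 1 ≡ + 2 * (u - b * t) - P * P
              lem = solve-∀

      A-odd : ∃ λ t → A x + + 1 ≡ + 2 * t
      A-odd = odd-quotient 2∤p (A x) (push φ χ x - b * δ e x) PA≡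

      -- For x ≢ e the term with b disappears, and the equation for p A x involves only the size of
      -- D ∩ xP, to which the count modulo p - 1 applies.
      A≢-1 : 3 ℕ.< p → e ≢ x → A x ≢ - + 1
      A≢-1 3<p e≢x A≡-1 = half-residue 2∤p 3<p (x ∈? D) (proj₁ (push-χ≡χ[mod-p-1] φx≡x)) (push φ χ x - b * δ e x)
        (trans (cong (λ z → P * z) (sym A≡-1)) PA≡)
        (trans (cong (λ t → push φ χ x - b * t) (δ-≢ e≢x)) (trans (lem (push φ χ x) b) (proj₂ (push-χ≡χ[mod-p-1] φx≡x))))
        where lem : ∀ u b → u - b * + 0 ≡ u
              lem = solve-∀

    -- On N the summand g x is (A x + 1)² - 4, which is negative only where A x = -1.
    no-such-A : 3 ℕ.< p → ⊥
    -- `1N x` unfolds to the bracket of `φ x ≟ x`, so `bound` can take this decision as an argument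
    -- and split on it.
    no-such-A 3<p = absurd (subst₂ ℤ._≤_ lower total (sum-mono-≤ (λ x → bound x (φ x ≟ x))))
      where
      g : Fin v → ℤ
      g x = A x * A x + (+ 2 * A x + - + 3 * 1N x)
      absurd : ¬ (- + 4 ℤ.≤ - + 16)
      absurd (ℤ.-≤- (ℕ.s≤s (ℕ.s≤s (ℕ.s≤s ()))))
      lower : sum (λ x → - + 4 * δ e x) ≡ - + 4
      lower = trans (sym (*-distribˡ-sum (- + 4) (δ e))) (cong (λ z → - + 4 * z) (sum-δ e))
      total : sum g ≡ - + 16
      total = begin
        sum g ≡⟨ ∑-distrib-+ (λ x → A x * A x) (λ x → + 2 * A x + - + 3 * 1N x) ⟩
        sum (λ x → A x * A x) + sum (λ x → + 2 * A x + - + 3 * 1N x)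
          ≡⟨ cong₂ _+_ sum-A² (∑-distrib-+ (λ x → + 2 * A x) (λ x → - + 3 * 1N x)) ⟩
        + 16 + (sum (λ x → + 2 * A x) + sum (λ x → - + 3 * 1N x))
          ≡⟨ cong₂ (λ z w → + 16 + (z + w)) (trans (sym (*-distribˡ-sum (+ 2) A)) (cong (λ z → + 2 * z) sum-A))
                                            (trans (sym (*-distribˡ-sum (- + 3) 1N)) (cong (λ z → - + 3 * z) ∣N∣≡8)) ⟩
        - + 16 ∎
        where open ≡-Reasoning
      A≡0 : ∀ {x} → φ x ≢ x → A x ≡ + 0
      A≡0 {x} φx≢x = ℤₚ.*-cancelˡ-≡ P (A x) (+ 0) (trans (sym (B≡PA x)) (trans (B-supp x (φx≢x ∘ 8·x≡e⇒φx≡x)) (sym (ℤₚ.*-zeroʳ P))))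
      bound : ∀ x (d : Dec (φ x ≡ x)) → - + 4 * δ e x ℤ.≤ A x * A x + (+ 2 * A x + - + 3 * [ d ]?)
      bound x (no φx≢x) = subst (- + 4 * δ e x ℤ.≤_) (cong (λ a → a * a + (+ 2 * a + - + 3 * + 0)) (sym (A≡0 φx≢x))) (-4δ≤0 x)
        where
        -4δ≤0 : ∀ x → - + 4 * δ e x ℤ.≤ + 0
        -4δ≤0 x with e ≟ x
        ... | yes _ = ℤ.-≤+
        ... | no _  = ℤ.+≤+ ℕ.z≤n
      bound x (yes φx≡x) = -4≤odd²+2odd-3 (A x) (OnN.A-odd φx≡x) (e ≟ x) (OnN.A≢-1 φx≡x 3<p)

  ¬3<p : ¬ 3 ℕ.< p
  ¬3<p = Quotient.no-such-A (λ x → quot (B≡0[mod-p] x))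
    (λ x → trans (a≡b+qs (B≡0[mod-p] x)) (trans (ℤₚ.+-identityˡ _) (ℤₚ.*-comm (quot (B≡0[mod-p] x)) P)))
    where open _≡_[mod_]

-- The parametrisation by y.

open import Data.Nat using (_≤_; _^_)

theorem3 : (y : ℤ) (p : ℕ) → + p ≡ + 4 * y * y + + 3 * y + + 1 → Prime p → 5 ≤ p →
    (β : ℤ) → (β ≡ - (+ 8 * y) - + 4 ⊎ β ≡ + 8 * y + + 2) →
    (mu lam k : ℤ) → mu ≡ + 2 * + p - + 2 → lam ≡ mu + β →
    + 2 * k ≡ + 2 * (+ 4 * + p * + p - + 2 * + p) + β →
    (G : FinAbGroup (Data.Nat._*_ 8 (p ^ 3))) (D : Subset (Data.Nat._*_ 8 (p ^ 3))) →
    ¬ (IsPDS G D k lam mu × IsRegular G D × ¬ IsTrivial G D)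
theorem3 y p p≡ p-prime 5≤p β β≡ mu lam k refl refl 2k≡ G D (isPDS , regular , _) =
  RegularPDS8p³.¬3<p {p = p} refl p-prime (ℕₚ.≤-trans (ℕ.s≤s (ℕ.s≤s (ℕ.s≤s ℕ.z≤n))) 5≤p) G D regular b b²+b≡4p-2
    (subst₂ (λ k β → IsPDS G D k (+ 2 * + p - + 2 + β) (+ 2 * + p - + 2)) k≡ β≡2b isPDS)
    (ℕₚ.≤-trans (ℕ.s≤s (ℕ.s≤s (ℕ.s≤s (ℕ.s≤s ℕ.z≤n)))) 5≤p)
  where
  -- The two values of β/2, namely -4y - 2 and 4y + 1, are the two roots of b² + b = 4p - 2, so one
  -- argument serves both signs.
  half : (β ≡ - (+ 8 * y) - + 4 ⊎ β ≡ + 8 * y + + 2) → ∃ λ b → β ≡ + 2 * b × b * b + b ≡ + 4 * (+ 4 * y * y + + 3 * y + + 1) - + 2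
  half (inj₁ β≡) = - (+ 4 * y) - + 2 , trans β≡ (lem y) , lem′ y
    where
    lem : ∀ y → - (+ 8 * y) - + 4 ≡ + 2 * (- (+ 4 * y) - + 2)
    lem = solve-∀
    lem′ : ∀ y → (- (+ 4 * y) - + 2) * (- (+ 4 * y) - + 2) + (- (+ 4 * y) - + 2) ≡ + 4 * (+ 4 * y * y + + 3 * y + + 1) - + 2
    lem′ = solve-∀
  half (inj₂ β≡) = + 4 * y + + 1 , trans β≡ (lem y) , lem′ y
    where
    lem : ∀ y → + 8 * y + + 2 ≡ + 2 * (+ 4 * y + + 1)
    lem = solve-∀
    lem′ : ∀ y → (+ 4 * y + + 1) * (+ 4 * y + + 1) + (+ 4 * y + + 1) ≡ + 4 * (+ 4 * y * y + + 3 * y + + 1) - + 2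
    lem′ = solve-∀
  b = proj₁ (half β≡)
  β≡2b = proj₁ (proj₂ (half β≡))
  b²+b≡4p-2 : b * b + b ≡ + 4 * + p - + 2
  b²+b≡4p-2 = trans (proj₂ (proj₂ (half β≡))) (cong (λ z → + 4 * z - + 2) (sym p≡))
  k≡ : k ≡ + 4 * + p * + p - + 2 * + p + b
  k≡ = ℤₚ.*-cancelˡ-≡ (+ 2) k _ (trans 2k≡ (trans (cong (λ z → + 2 * (+ 4 * + p * + p - + 2 * + p) + z) β≡2b)
    (sym (ℤₚ.*-distribˡ-+ (+ 2) (+ 4 * + p * + p - + 2 * + p) b))))
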